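{- Let $k \geq 4$ and $G$ a $k$-dicritical digraph. If $G$ is not $\overset \leftrightarrow K_k$, then \[\lvert A(G)\rvert \ge (k-1) \lvert V(G)\rvert + k-3.\]
   Context: Digraphs are simple (no loops, no parallel arcs; a digon, i.e. a pair of opposite arcs $uv,vu$, is allowed). A dicolouring of a digraph is a partition of its vertex set into sets inducing acyclic subdigraphs; the dichromatic number $\vec{\chi}(G)$ is the minimum number of parts of such a partition. A digraph $G$ is $k$-dicritical if $\vec{\chi}(G)=k$ and every proper subdigraph $H$ of $G$ satisfies $\vec{\chi}(H) \le k-1$. $\overset \leftrightarrow K_k$ denotes the complete symmetric digraph on $k$ vertices (every pair of distinct vertices joined by a digon). -}

module Defs where

open import Data.Nat using (ℕ; zero; suc; _+_; _∸_)
open import Data.Bool using (Bool; true; false; if_then_else_)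
open import Data.Fin using (Fin; zero; suc; inject₁; fromℕ)
open import Data.List using (List; map; allFin)
open import Data.Nat.ListAction using (sum)
open import Data.Product using (Σ; _×_; ∃)
open import Data.Sum using (_⊎_)
open import Relation.Binary.PropositionalEquality using (_≡_; _≢_)
open import Relation.Nullary using (¬_)
open import Function.Definitions using (Injective)
open import Function.Bundles using (_⤖_; Bijection)

-- A simple digraph on vertex set Fin n: arc relation given by a Boolean
-- matrix, no loops.  Parallel arcs are impossible; digons are allowed.
record Digraph : Set where
  field
    n     : ℕ
    arc   : Fin n → Fin n → Bool
    loopless : ∀ v → arc v v ≡ false
open Digraph public

arcCount : Digraph → ℕ
arcCount G = sum (map (λ u → sum (map (λ v → if arc G u v then 1 else 0) (allFin (n G)))) (allFin (n G)))

Cycle : {N : ℕ} → (S : Fin N → Set) → (R : Fin N → Fin N → Set) → (Fin N → Set) → Set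
Cycle {N} S R P =
  Σ ℕ λ m → Σ (Fin (suc (suc m)) → Fin N) λ f →
    Injective _≡_ _≡_ f
    × (∀ i → S (f i))
    × (∀ i → P (f i))
    × (∀ (i : Fin (suc m)) → R (f (inject₁ i)) (f (suc i)))
    × R (f (fromℕ (suc m))) (f zero)

Dicolourable : {N : ℕ} → (S : Fin N → Set) → (R : Fin N → Fin N → Set) → ℕ → Set
Dicolourable {N} S R k =
  Σ (Fin N → Fin k) λ c → ∀ (j : Fin k) → ¬ Cycle S R (λ v → c v ≡ j)

DicolourableG : Digraph → ℕ → Set
DicolourableG G k = Dicolourable {n G} (λ _ → Fin (n G)) (λ u v → arc G u v ≡ true) k

DichromaticNumber : Digraph → ℕ → Set
DichromaticNumber G k = DicolourableG G k × ¬ DicolourableG G (k ∸ 1)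

record Subdigraph (G : Digraph) : Set where
  field
    inV : Fin (n G) → Bool
    inA : Fin (n G) → Fin (n G) → Bool
    inA⊆ : ∀ u v → inA u v ≡ true → (arc G u v ≡ true) × (inV u ≡ true) × (inV v ≡ true)
open Subdigraph public

Proper : {G : Digraph} → Subdigraph G → Set
Proper {G} H = ¬ ((∀ v → inV H v ≡ true) × (∀ u v → inA H u v ≡ arc G u v))

DicolourableSub : {G : Digraph} → Subdigraph G → ℕ → Set
DicolourableSub {G} H k =
  Dicolourable {n G} (λ v → inV H v ≡ true) (λ u v → inA H u v ≡ true) k

Dicritical : ℕ → Digraph → Set
Dicritical k G = DichromaticNumber G k × (∀ (H : Subdigraph G) → Proper H → DicolourableSub H (k ∸ 1))

neqB : {k : ℕ} → Fin k → Fin k → Bool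
neqB zero zero = false
neqB zero (suc _) = true
neqB (suc _) zero = true
neqB (suc i) (suc j) = neqB i j

neqB-refl : {k : ℕ} (v : Fin k) → neqB v v ≡ false
neqB-refl zero = Relation.Binary.PropositionalEquality.refl
neqB-refl (suc v) = neqB-refl v

CompleteSym : ℕ → Digraph
CompleteSym k = record { n = k ; arc = neqB ; loopless = neqB-refl }

Isomorphic : Digraph → Digraph → Set
Isomorphic G H = Σ (Fin (n G) ⤖ Fin (n H)) λ f →
  ∀ u v → arc G u v ≡ arc H (Bijection.to f u) (Bijection.to f v)

{-# OPTIONS --safe #-}
module Submission where

open import Defs
open import Data.Nat using (ℕ; _+_; _*_; _∸_; _≥_)
open import Relation.Nullary using (¬_)

open import Data.Bool using (Bool; true; false; _∧_; _∨_; not; if_then_else_)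
import Data.Bool.Properties as Bool
open import Data.Empty using (⊥; ⊥-elim)
open import Data.Fin using (Fin; zero; suc; toℕ; fromℕ<; inject₁; fromℕ)
open import Data.Fin.Induction using (<-weakInduction)
import Data.Fin.Properties as Fin
open import Data.Fin.Properties using (_≟_; any?; all?; pigeonhole; toℕ<n; toℕ-injective; toℕ-fromℕ<; toℕ-inject₁; toℕ-fromℕ)
open import Data.List using (allFin; tabulate; map)
open import Data.List.Properties using (map-tabulate)
import Data.Nat as ℕ
open import Data.Nat using (zero; suc; _≤_; _<_; z≤n; s≤s; _≤?_; NonZero)
open import Data.Nat.DivMod using (_%_; m%n<n; %-distribˡ-+; m<n⇒m%n≡m; [m+n]%n≡m%n)
open import Data.Nat.ListAction using () renaming (sum to sumList)
open import Data.Nat.Properties hiding (_≟_)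
open import Data.Nat.Solver using (module +-*-Solver)
open import Data.Product using (Σ; ∃; _×_; _,_; proj₁; proj₂)
open import Data.Sum using (_⊎_; inj₁; inj₂)
import Data.Sum as Sum
open import Algebra.Properties.Semiring.Sum +-*-semiring using (sum; sum-cong-≗; ∑-distrib-+; ∑-comm; *-distribˡ-sum)
open import Function using (_∘_; flip)
open import Function.Construct.Identity using (⤖-id)
open import Function.Definitions using (Injective)
open import Relation.Binary.Definitions using (tri<; tri≈; tri>)
open import Relation.Binary.PropositionalEquality using (_≡_; _≢_; refl; sym; trans; cong; cong₂; subst; subst₂; module ≡-Reasoning)
open import Relation.Nullary using (Dec; yes; no; does; contradiction)
open import Relation.Nullary.Decidable using (_×-dec_; ¬?; dec-true; dec-false; decidable-stable)
open +-*-Solver using (solve; _:=_; _:+_; con)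

-- Write N = k - 1 and let the excess of a digraph be the sum of d⁺(v) - N over its non-isolated
-- vertices; the claim is that the excess is at least N - 2. Isolated vertices play no role, so a
-- digraph is just a Boolean matrix on a fixed vertex set.
--
-- In a critical digraph fewer than N arcs cannot leave a set of vertices: shift the colouring of
-- the complement cyclically. Now let x, y be out-neighbours of a vertex v with d⁺(v) = N and
-- suppose x, y do not form a digon. Identifying x and y gives a digraph which is not
-- N-colourable and whose critical subdigraphs miss v; the N arcs leaving one of these pay for the
-- lost vertex, so its excess is at most that of the original digraph. By induction we may assume
-- that it is complete on N + 1 vertices, and then the original digraph contains a complete digraph
-- Q on N vertices.
--
-- If the excess is less than N - 2, at least three vertices of Q have a single out-neighbour
-- outside Q and at least three a single in-neighbour. All these neighbours coincide: if two of
-- them, z and z′, differ, every colouring of the complement of Q in which their colours differ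
-- extends greedily to Q, so the complement with a digon zz′ added is not N-colourable, and a
-- critical subdigraph of it has N arcs leaving it, against two new ones. As Q + z is not
-- complete, z can be identified with some q in Q, which yields a second clique Q′ of size N;
-- counting the arcs from {z, q} into Q and Q′ shows that the excess is at least N - 2 after all.

-- Booleans and decidable equality

∧-elim : ∀ {a b} → a ∧ b ≡ true → a ≡ true × b ≡ true
∧-elim {true} {true} _ = refl , refl

∧-intro : ∀ {a b} → a ≡ true → b ≡ true → a ∧ b ≡ true
∧-intro refl refl = refl

∨-elim : ∀ {a b} → a ∨ b ≡ true → a ≡ true ⊎ b ≡ true
∨-elim {true} _ = inj₁ refl
∨-elim {false} p = inj₂ p

∨-introˡ : ∀ {a b} → a ≡ true → a ∨ b ≡ true
∨-introˡ refl = refl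

∨-introʳ : ∀ {a b} → b ≡ true → a ∨ b ≡ true
∨-introʳ {true} _ = refl
∨-introʳ {false} p = p

not-elim : ∀ {a} → not a ≡ true → a ≡ false
not-elim {false} _ = refl

not-intro : ∀ {a} → a ≡ false → not a ≡ true
not-intro refl = refl

true≢false : ∀ {a} → a ≡ true → a ≡ false → ⊥
true≢false refl ()

false-intro : ∀ {a} → (a ≡ true → ⊥) → a ≡ false
false-intro {true} h = ⊥-elim (h refl)
false-intro {false} _ = refl

bool-split : ∀ a → a ≡ true ⊎ a ≡ false
bool-split true = inj₁ refl
bool-split false = inj₂ refl

does-elim : ∀ {P : Set} (P? : Dec P) → does P? ≡ true → P
does-elim (yes p) _ = p

does-elim-false : ∀ {P : Set} (P? : Dec P) → does P? ≡ false → ¬ P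
does-elim-false (no ¬p) _ = ¬p

-- Colourability is not decided here, so existence claims about colourings, critical subdigraphs and
-- forks carry a double negation. It is shed whenever the goal is absurdity or a decidable
-- inequality.
em : {P : Set} → ¬ ¬ (P ⊎ ¬ P)
em k = k (inj₂ (k ∘ inj₁))

_==_ : ∀ {m} → Fin m → Fin m → Bool
u == v = does (u ≟ v)

==⇒≡ : ∀ {m} (u v : Fin m) → u == v ≡ true → u ≡ v
==⇒≡ u v = does-elim (u ≟ v)

==-refl : ∀ {m} (u : Fin m) → u == u ≡ true
==-refl u = dec-true (u ≟ u) refl

≢⇒== : ∀ {m} {u v : Fin m} → u ≢ v → u == v ≡ false
≢⇒== {u = u} {v} = dec-false (u ≟ v)

==⇒≢ : ∀ {m} (u v : Fin m) → u == v ≡ false → u ≢ v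
==⇒≢ u v = does-elim-false (u ≟ v)

-- Finite sums and cardinalities

sum-mono : ∀ {m} {f g : Fin m → ℕ} → (∀ i → f i ≤ g i) → sum f ≤ sum g
sum-mono {zero} h = z≤n
sum-mono {suc m} h = +-mono-≤ (h zero) (sum-mono (h ∘ suc))

term≤sum : ∀ {m} (f : Fin m → ℕ) i → f i ≤ sum f
term≤sum f zero = m≤m+n _ _
term≤sum f (suc i) = ≤-trans (term≤sum (f ∘ suc) i) (m≤n+m _ _)

sum<⇒∃ : ∀ {m} (f g : Fin m → ℕ) → sum f < sum g → ∃ λ i → f i < g i
sum<⇒∃ f g lt with any? (λ i → f i <? g i)
... | yes p = p
... | no ¬p = contradiction (sum-mono λ i → ≮⇒≥ λ q → ¬p (i , q)) (<⇒≱ lt)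

[_] : Bool → ℕ
[ true ] = 1
[ false ] = 0

[true] : ∀ {b} → b ≡ true → [ b ] ≡ 1
[true] refl = refl

[false] : ∀ {b} → b ≡ false → [ b ] ≡ 0
[false] refl = refl

[]≥1 : ∀ {b} → b ≡ true → 1 ≤ [ b ]
[]≥1 refl = ≤-refl

[]≤ : ∀ b {k} → (b ≡ true → 1 ≤ k) → [ b ] ≤ k
[]≤ true h = h refl
[]≤ false _ = z≤n

[]≤1 : ∀ b → [ b ] ≤ 1
[]≤1 b = []≤ b λ _ → ≤-refl

[]-mono : ∀ {a b} → (a ≡ true → b ≡ true) → [ a ] ≤ [ b ]
[]-mono {a} h = []≤ a λ p → ≤-reflexive (sym ([true] (h p)))

-- The pointwise tool for counting: two kinds of arcs share the budget k, and their disjointness, if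
-- any, enters through the last hypothesis.
[]+[]≤ : ∀ a b {k} → (a ≡ true → 1 ≤ k) → (b ≡ true → 1 ≤ k) → (a ≡ true → b ≡ true → 2 ≤ k) →
         [ a ] + [ b ] ≤ k
[]+[]≤ true true _ _ h = h refl refl
[]+[]≤ true false h _ _ = h refl
[]+[]≤ false b _ h _ = []≤ b h

card : ∀ {m} → (Fin m → Bool) → ℕ
card P = sum λ u → [ P u ]

sum-point : ∀ {m} (x : Fin m) a → sum (λ u → [ u == x ] * a) ≡ a
sum-point {suc m} zero a = trans (cong₂ _+_ (+-identityʳ a) (none m)) (+-identityʳ a)
  where
  none : ∀ m → sum {m} (λ u → [ suc u == zero {m} ] * a) ≡ 0
  none zero = refl
  none (suc m) = none m
sum-point {suc m} (suc x) a = sum-point x a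

sum-point₁ : ∀ {m} (x : Fin m) → card (_== x) ≡ 1
sum-point₁ x = trans (sum-cong-≗ λ u → sym (*-identityʳ [ u == x ])) (sum-point x 1)

sum-const-1 : ∀ m → sum {m} (λ _ → 1) ≡ m
sum-const-1 zero = refl
sum-const-1 (suc m) = cong suc (sum-const-1 m)

card≤ : ∀ {m} (P : Fin m → Bool) → card P ≤ m
card≤ {m} P = ≤-trans (sum-mono ([]≤1 ∘ P)) (≤-reflexive (sum-const-1 m))

card-mono : ∀ {m} {P Q : Fin m → Bool} → (∀ u → P u ≡ true → Q u ≡ true) → card P ≤ card Q
card-mono h = sum-mono λ u → []-mono (h u)

card<⇒∃ : ∀ {m} (P Q : Fin m → Bool) → card P < card Q → ∃ λ u → Q u ≡ true × P u ≡ false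
card<⇒∃ P Q lt with u , p ← sum<⇒∃ _ _ lt = u , strict (P u) (Q u) p
  where
  strict : ∀ a b → [ a ] < [ b ] → b ≡ true × a ≡ false
  strict false true _ = refl , refl
  strict true true (s≤s ())

sum-zero : ∀ {m} (f : Fin m → ℕ) → (∀ i → f i ≡ 0) → sum f ≡ 0
sum-zero {zero} f h = refl
sum-zero {suc m} f h = cong₂ _+_ (h zero) (sum-zero (f ∘ suc) (h ∘ suc))

card-positive⇒∃ : ∀ {m} (P : Fin m → Bool) → 1 ≤ card P → ∃ λ u → P u ≡ true
card-positive⇒∃ {m} P h with card<⇒∃ (λ _ → false) P (≤-trans (s≤s (≤-reflexive (sum-zero {m} _ λ _ → refl))) h)
... | u , p , _ = u , p

∃-other : ∀ {m} (P : Fin m → Bool) x → 2 ≤ card P → ∃ λ u → P u ≡ true × u ≢ x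
∃-other P x h with u , p , q ← card<⇒∃ (_== x) P (≤-trans (≤-reflexive (cong suc (sum-point₁ x))) h) =
  u , p , ==⇒≢ u x q

card-unique : ∀ {m} (P : Fin m → Bool) → (∀ i j → P i ≡ true → P j ≡ true → i ≡ j) → card P ≤ 1
card-unique P h with 2 ≤? card P
... | no p = ≤-pred (≰⇒> p)
... | yes p with i , Pi ← card-positive⇒∃ P (<⇒≤ p) with j , Pj , j≢i ← ∃-other P i p =
  contradiction (h j i Pj Pi) j≢i

card-insert : ∀ {m} (P Q : Fin m → Bool) x → P x ≡ false → Q x ≡ true → (∀ u → P u ≡ true → Q u ≡ true) →
              suc (card P) ≤ card Q
card-insert {m} P Q x Px Qx h = begin
  suc (card P)                      ≡⟨ cong (_+ card P) (sym (sum-point₁ x)) ⟩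
  card (_== x) + card P             ≡⟨ sym (∑-distrib-+ {m} _ _) ⟩
  sum (λ u → [ u == x ] + [ P u ])  ≤⟨ sum-mono (λ u → []+[]≤ (u == x) (P u) (at u) (else u) (both u)) ⟩
  card Q                            ∎
  where
  open ≤-Reasoning
  at : ∀ u → u == x ≡ true → 1 ≤ [ Q u ]
  at u e = []≥1 (subst (λ v → Q v ≡ true) (sym (==⇒≡ u x e)) Qx)
  else : ∀ u → P u ≡ true → 1 ≤ [ Q u ]
  else u p = []≥1 (h u p)
  both : ∀ u → u == x ≡ true → P u ≡ true → 2 ≤ [ Q u ]
  both u e p = ⊥-elim (true≢false p (subst (λ v → P v ≡ false) (sym (==⇒≡ u x e)) Px))

card-remove : ∀ {m} (P : Fin m → Bool) x → P x ≡ true → suc (card (λ u → P u ∧ not (u == x))) ≡ card P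
card-remove {m} P x Px = begin-equality
  suc (card (λ u → P u ∧ not (u == x)))                  ≡⟨ cong (_+ card (λ u → P u ∧ not (u == x))) (sym (sum-point₁ x)) ⟩
  card (_== x) + card (λ u → P u ∧ not (u == x))         ≡⟨ sym (∑-distrib-+ {m} _ _) ⟩
  sum (λ u → [ u == x ] + [ P u ∧ not (u == x) ])        ≡⟨ sum-cong-≗ pointwise ⟩
  card P                                                 ∎
  where
  open ≤-Reasoning
  pointwise : ∀ u → [ u == x ] + [ P u ∧ not (u == x) ] ≡ [ P u ]
  pointwise u with u ≟ x
  ... | no _ = cong [_] (Bool.∧-identityʳ (P u))
  ... | yes refl rewrite Px = refl

hit? : ∀ {m N} (c : Fin m → Fin N) (P : Fin m → Bool) j → Dec (∃ λ w → P w ≡ true × c w ≡ j)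
hit? c P j = any? λ w → (P w Bool.≟ true) ×-dec (c w ≟ j)

image : ∀ {m N} → (Fin m → Fin N) → (Fin m → Bool) → Fin N → Bool
image c P j = does (hit? c P j)

-- Double counting of the pairs of a vertex w in P and its colour: every colour of the image has at
-- least one pair, every w exactly one.
card-image : ∀ {m N} (c : Fin m → Fin N) (P : Fin m → Bool) → card (image c P) ≤ card P
card-image {m} {N} c P = begin
  card (image c P)                                     ≤⟨ sum-mono hit ⟩
  sum (λ j → sum λ w → [ j == c w ] * [ P w ])         ≡⟨ ∑-comm {N} {m} _ ⟩
  sum (λ w → sum λ j → [ j == c w ] * [ P w ])         ≡⟨ sum-cong-≗ (λ w → sum-point (c w) [ P w ]) ⟩
  card P                                               ∎
  where
  open ≤-Reasoning
  hit : ∀ j → [ image c P j ] ≤ sum λ w → [ j == c w ] * [ P w ]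
  hit j = []≤ (image c P j) λ p → go (does-elim (hit? c P j) p)
    where
    go : (∃ λ w → P w ≡ true × c w ≡ j) → 1 ≤ sum λ w → [ j == c w ] * [ P w ]
    go (w , Pw , refl) = ≤-trans
      (≤-reflexive (sym (cong₂ _*_ ([true] (==-refl (c w))) ([true] Pw))))
      (term≤sum (λ v → [ c w == c v ] * [ P v ]) w)

-- The same double count, with injectivity on P leaving at most one pair per colour.
card-injective : ∀ {m N} (c : Fin m → Fin N) (P : Fin m → Bool) →
  (∀ u v → P u ≡ true → P v ≡ true → c u ≡ c v → u ≡ v) → card P ≤ N
card-injective {m} {N} c P inj = begin
  card P                                             ≡⟨ sum-cong-≗ (λ w → sym (sum-point (c w) [ P w ])) ⟩
  sum (λ w → sum λ j → [ j == c w ] * [ P w ])       ≡⟨ ∑-comm {m} {N} _ ⟩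
  sum (λ j → sum λ w → [ j == c w ] * [ P w ])       ≤⟨ sum-mono fibre ⟩
  sum {N} (λ _ → 1)                                  ≡⟨ sum-const-1 N ⟩
  N                                                  ∎
  where
  open ≤-Reasoning
  []*[] : ∀ a b → [ a ] * [ b ] ≡ [ a ∧ b ]
  []*[] true b = +-identityʳ _
  []*[] false b = refl
  fibre : ∀ j → sum (λ w → [ j == c w ] * [ P w ]) ≤ 1
  fibre j = ≤-trans (≤-reflexive (sum-cong-≗ λ w → []*[] (j == c w) (P w)))
    (card-unique _ λ u v p q → inj u v (proj₂ (∧-elim {j == c u} p)) (proj₂ (∧-elim {j == c v} q))
      (trans (sym (==⇒≡ j (c u) (proj₁ (∧-elim p)))) (==⇒≡ j (c v) (proj₁ (∧-elim q)))))

-- Addition modulo N. Injectivity in b keeps a shifted colouring valid; injectivity in s makes a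
-- given arc monochromatic for at most one shift.
rotate : ∀ {N} .{{_ : NonZero N}} → Fin N → Fin N → Fin N
rotate {N} s b = fromℕ< (m%n<n (toℕ s + toℕ b) N)

rotate-injectiveʳ : ∀ {N} .{{_ : NonZero N}} (s : Fin N) {b b′} → rotate s b ≡ rotate s b′ → b ≡ b′
rotate-injectiveʳ {N} s {b} {b′} e =
  toℕ-injective (trans (sym (undo b)) (trans (cong (λ t → (t + (N ∸ toℕ s)) % N) e′) (undo b′)))
  where
  open ≤-Reasoning
  e′ : (toℕ s + toℕ b) % N ≡ (toℕ s + toℕ b′) % N
  e′ = trans (sym (toℕ-fromℕ< _)) (trans (cong toℕ e) (toℕ-fromℕ< _))
  -- Adding N - s cancels the shift by s.
  undo : ∀ b → ((toℕ s + toℕ b) % N + (N ∸ toℕ s)) % N ≡ toℕ b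
  undo b = begin-equality
    ((toℕ s + toℕ b) % N + (N ∸ toℕ s)) % N               ≡⟨ %-distribˡ-+ ((toℕ s + toℕ b) % N) (N ∸ toℕ s) N ⟩
    ((toℕ s + toℕ b) % N % N + (N ∸ toℕ s) % N) % N       ≡⟨ cong (λ t → (t + (N ∸ toℕ s) % N) % N) (m<n⇒m%n≡m (m%n<n (toℕ s + toℕ b) N)) ⟩
    ((toℕ s + toℕ b) % N + (N ∸ toℕ s) % N) % N           ≡⟨ sym (%-distribˡ-+ (toℕ s + toℕ b) (N ∸ toℕ s) N) ⟩
    (toℕ s + toℕ b + (N ∸ toℕ s)) % N                     ≡⟨ cong (_% N) (cong (_+ (N ∸ toℕ s)) (+-comm (toℕ s) (toℕ b))) ⟩
    (toℕ b + toℕ s + (N ∸ toℕ s)) % N                     ≡⟨ cong (_% N) (+-assoc (toℕ b) (toℕ s) _) ⟩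
    (toℕ b + (toℕ s + (N ∸ toℕ s))) % N                   ≡⟨ cong (λ t → (toℕ b + t) % N) (m+[n∸m]≡n (<⇒≤ (toℕ<n s))) ⟩
    (toℕ b + N) % N                                       ≡⟨ [m+n]%n≡m%n (toℕ b) N ⟩
    toℕ b % N                                             ≡⟨ m<n⇒m%n≡m (toℕ<n b) ⟩
    toℕ b                                                 ∎

rotate-injectiveˡ : ∀ {N} .{{_ : NonZero N}} (b : Fin N) {s s′} → rotate s b ≡ rotate s′ b → s ≡ s′
rotate-injectiveˡ b {s} {s′} e = rotate-injectiveʳ b (trans (swap b s) (trans e (swap s′ b)))
  where
  swap : ∀ {N} .{{_ : NonZero N}} (s b : Fin N) → rotate s b ≡ rotate b s
  swap {N} s b = toℕ-injective (trans (toℕ-fromℕ< _)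
    (trans (cong (_% N) (+-comm (toℕ s) (toℕ b))) (sym (toℕ-fromℕ< _))))

sum-mono-< : ∀ {m} {f g : Fin m → ℕ} i → (∀ j → f j ≤ g j) → f i < g i → sum f < sum g
sum-mono-< zero h lt = +-mono-<-≤ lt (sum-mono (h ∘ suc))
sum-mono-< (suc i) h lt = +-mono-≤-< (h zero) (sum-mono-< i (h ∘ suc) lt)

if-true : ∀ {A : Set} {b} {x y : A} → b ≡ true → (if b then x else y) ≡ x
if-true refl = refl

if-false : ∀ {A : Set} {b} {x y : A} → b ≡ false → (if b then x else y) ≡ y
if-false refl = refl

-- Critical digraphs as Boolean relations; degrees and cuts

module Critical (m N : ℕ) where

  VSet Rel : Set
  VSet = Fin m → Bool
  Rel = Fin m → Fin m → Bool

  -- A dicolouring is certified by ranks that increase along monochromatic arcs.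
  Col : Rel → Set
  Col A = Σ (Fin m → Fin N) λ c → Σ (Fin m → ℕ) λ r → ∀ u v → A u v ≡ true → c u ≡ c v → r u < r v

  Irreflexive : Rel → Set
  Irreflexive A = ∀ v → A v v ≡ false

  _⊆_ : Rel → Rel → Set
  B ⊆ A = ∀ u v → B u v ≡ true → A u v ≡ true

  -- Vertices are never deleted, since isolated ones do not affect colourability; a proper
  -- subdigraph is one that misses an arc. With the double negation, `critical-subdigraph` need not
  -- decide colourability.
  record Crit (A : Rel) : Set where
    field
      irr  : Irreflexive A
      ¬col : ¬ Col A
      crit : ∀ B → B ⊆ A → ∀ u v → A u v ≡ true → B u v ≡ false → ¬ ¬ Col B
  open Crit

  arc⇒≢ : ∀ {A} → Crit A → ∀ {u v} → A u v ≡ true → u ≢ v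
  arc⇒≢ C {u} a refl = true≢false a (irr C u)

  deg : Rel → Fin m → ℕ
  deg A u = card (A u)

  -- Truncated subtraction makes isolated vertices contribute zero; at every other vertex of a
  -- critical relation it is exact by `min-degree`.
  excess : Rel → ℕ
  excess A = sum λ u → deg A u ∸ N

  -- Reversing the arcs reverses the order of the ranks; `sum r` serves as an upper bound for all of
  -- them.
  Col-flip : ∀ A → Col A → Col (flip A)
  Col-flip A (c , r , h) = c , (λ u → sum r ∸ r u) , λ u v a e → ∸-monoʳ-< (h v u a (sym e)) (term≤sum r u)

  Crit-flip : ∀ {A} → Crit A → Crit (flip A)
  Crit-flip C .irr = irr C
  Crit-flip {A} C .¬col k = ¬col C (Col-flip (flip A) k)
  Crit-flip C .crit B s u v a b k = crit C (flip B) (λ x y → s y x) v u a b (k ∘ Col-flip (flip B))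

  -- All ranks in W are lifted above those of the complement, so arcs entering W are harmless and
  -- only arcs leaving W must not be monochromatic.
  glue : ∀ A (W : VSet) (c₁ : Fin m → Fin N) (r₁ : Fin m → ℕ) (c₂ : Fin m → Fin N) (r₂ : Fin m → ℕ) →
    (∀ u w → A u w ≡ true → W u ≡ true → W w ≡ true → c₁ u ≡ c₁ w → r₁ u < r₁ w) →
    (∀ u w → A u w ≡ true → W u ≡ false → W w ≡ false → c₂ u ≡ c₂ w → r₂ u < r₂ w) →
    (∀ u w → A u w ≡ true → W u ≡ true → W w ≡ false → c₁ u ≢ c₂ w) → Col A
  glue A W c₁ r₁ c₂ r₂ h₁ h₂ h₁₂ = c , r , ok
    where
    c : Fin m → Fin N
    c u = if W u then c₁ u else c₂ u
    r : Fin m → ℕ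
    r u = if W u then suc (sum r₂ + r₁ u) else r₂ u
    ok : ∀ u w → A u w ≡ true → c u ≡ c w → r u < r w
    ok u w a e with bool-split (W u) | bool-split (W w)
    ... | inj₁ p | inj₁ q = subst₂ _<_ (sym (if-true p)) (sym (if-true q))
      (s≤s (+-monoʳ-< (sum r₂) (h₁ u w a p q (trans (sym (if-true p)) (trans e (if-true q))))))
    ... | inj₁ p | inj₂ q = contradiction (trans (sym (if-true p)) (trans e (if-false q))) (h₁₂ u w a p q)
    ... | inj₂ p | inj₁ q = subst₂ _<_ (sym (if-false p)) (sym (if-true q))
      (s≤s (≤-trans (term≤sum r₂ u) (m≤m+n _ _)))
    ... | inj₂ p | inj₂ q = subst₂ _<_ (sym (if-false p)) (sym (if-false q))
      (h₂ u w a p q (trans (sym (if-false p)) (trans e (if-false q))))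

  restrict : Rel → VSet → Rel
  restrict A P u w = A u w ∧ (P u ∧ P w)

  restrict-intro : ∀ A P {u w} → A u w ≡ true → P u ≡ true → P w ≡ true → restrict A P u w ≡ true
  restrict-intro A P a p q = ∧-intro a (∧-intro p q)

  restrict⊆ : ∀ A P → restrict A P ⊆ A
  restrict⊆ A P u w = proj₁ ∘ ∧-elim

  restrict-Col : ∀ {A} → Crit A → ∀ P u w → A u w ≡ true → P u ∧ P w ≡ false → ¬ ¬ Col (restrict A P)
  restrict-Col {A} C P u w a p = crit C (restrict A P) (restrict⊆ A P) u w a
    (false-intro λ t → true≢false (proj₂ (∧-elim {A u w} t)) p)

  -- The arc at v makes A - v a proper subdigraph, hence colourable. If v had fewer than N
  -- out-neighbours, some colour would be absent from them; v could take it and be ranked above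
  -- everything else.
  min-degree : ∀ {A} → Crit A → ∀ v w → A v w ≡ true ⊎ A w v ≡ true → N ≤ deg A v
  min-degree {A} C v w a = decidable-stable (N ≤? deg A v) λ small →
      coloured a λ { (c , r , h) → ¬col C (extend c r h (unused c (≰⇒> small))) }
    where
    P : VSet
    P u = not (u == v)
    ∉P : P v ≡ false
    ∉P = cong not (==-refl v)
    coloured : A v w ≡ true ⊎ A w v ≡ true → ¬ ¬ Col (restrict A P)
    coloured (inj₁ a) = restrict-Col C P v w a (cong (_∧ P w) ∉P)
    coloured (inj₂ a) = restrict-Col C P w v a (trans (cong (P w ∧_) ∉P) (Bool.∧-zeroʳ (P w)))
    unused : (c : Fin m → Fin N) → deg A v < N → ∃ λ j → image c (A v) j ≡ false
    unused c lt with card<⇒∃ (image c (A v)) (λ _ → true)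
      (≤-trans (s≤s (card-image c (A v))) (≤-trans lt (≤-reflexive (sym (sum-const-1 N)))))
    ... | j , _ , p = j , p
    extend : (c : Fin m → Fin N) (r : Fin m → ℕ) →
      (∀ x y → restrict A P x y ≡ true → c x ≡ c y → r x < r y) →
      (∃ λ j → image c (A v) j ≡ false) → Col A
    extend c r h (j , free) = glue A (_== v) (λ _ → j) (λ _ → 0) c r
      (λ x y a p q _ → contradiction (trans (==⇒≡ x v p) (sym (==⇒≡ y v q))) (arc⇒≢ C a))
      (λ x y a p q e → h x y (restrict-intro A P a (not-intro p) (not-intro q)) e)
      (λ x y a p q e → does-elim-false (hit? c (A v) j) free
        (y , subst (λ z → A z y ≡ true) (==⇒≡ x v p) a , sym e))

  cutSize : Rel → VSet → ℕ
  cutSize A W = sum λ u → sum λ w → [ W u ∧ (not (W w) ∧ A u w) ]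

  -- Of the N cyclic shifts of a colouring of the complement of W, an arc leaving W is
  -- monochromatic in at most one, so fewer than N such arcs leave a good shift.
  cut : .{{_ : NonZero N}} → ∀ {A} → Crit A → (W : VSet) → ∀ {a b a′ b′} →
    A a b ≡ true → W a ≡ true → A a′ b′ ≡ true → W a′ ≡ false → N ≤ cutSize A W
  cut {A} C W {a} {b} {a′} {b′} ab Wa ab′ Wa′ = decidable-stable (N ≤? cutSize A W) λ small →
      -- Both sides induce proper subdigraphs: the arc from a′ is missing on W and the arc from a on
      -- its complement.
      restrict-Col C W a′ b′ ab′ (cong (_∧ W b′) Wa′) λ { (c₁ , r₁ , h₁) →
      restrict-Col C (not ∘ W) a b ab (cong (_∧ not (W b)) (cong not Wa)) λ { (c₂ , r₂ , h₂) →
      ¬col C (combine c₁ r₁ h₁ c₂ r₂ h₂ (goodShift c₁ c₂ (≰⇒> small))) }}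
    where
    cross : Rel
    cross u w = W u ∧ (not (W w) ∧ A u w)
    clash : (c₁ c₂ : Fin m → Fin N) → Fin N → Rel
    clash c₁ c₂ s u w = cross u w ∧ (c₁ u == rotate s (c₂ w))
    clashes : (c₁ c₂ : Fin m → Fin N) → Fin N → ℕ
    clashes c₁ c₂ s = sum λ u → sum λ w → [ clash c₁ c₂ s u w ]
    weak : ∀ b (P : Fin N → Bool) → card P ≤ 1 → card (λ s → b ∧ P s) ≤ [ b ]
    weak true P h = h
    weak false P h = ≤-reflexive (sum-zero {N} _ λ _ → refl)
    total : ∀ c₁ c₂ → sum (clashes c₁ c₂) ≤ cutSize A W
    total c₁ c₂ = begin
      sum (λ s → sum λ u → sum λ w → [ clash c₁ c₂ s u w ])  ≡⟨ ∑-comm {N} {m} _ ⟩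
      sum (λ u → sum λ s → sum λ w → [ clash c₁ c₂ s u w ])  ≡⟨ sum-cong-≗ {m} (λ u → ∑-comm {N} {m} _) ⟩
      sum (λ u → sum λ w → sum λ s → [ clash c₁ c₂ s u w ])  ≤⟨ sum-mono (λ u → sum-mono λ w → weak (cross u w) _
                                                                   (card-unique _ λ s s′ p q → rotate-injectiveˡ (c₂ w)
                                                                     (trans (sym (==⇒≡ (c₁ u) _ p)) (==⇒≡ (c₁ u) _ q)))) ⟩
      cutSize A W                                            ∎
      where open ≤-Reasoning
    goodShift : ∀ c₁ c₂ → cutSize A W < N → ∃ λ s → ∀ u w → clash c₁ c₂ s u w ≡ false
    goodShift c₁ c₂ lt with sum<⇒∃ (clashes c₁ c₂) (λ _ → 1)
      (≤-trans (s≤s (total c₁ c₂)) (≤-trans lt (≤-reflexive (sym (sum-const-1 N)))))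
    ... | s , none = s , λ u w → false-intro λ t → <⇒≱ none (begin
        1                                                ≡⟨ sym ([true] t) ⟩
        [ clash c₁ c₂ s u w ]                            ≤⟨ term≤sum (λ w → [ clash c₁ c₂ s u w ]) w ⟩
        sum (λ w → [ clash c₁ c₂ s u w ])                ≤⟨ term≤sum (λ u → sum λ w → [ clash c₁ c₂ s u w ]) u ⟩
        clashes c₁ c₂ s                                  ∎)
      where open ≤-Reasoning
    combine : ∀ c₁ (r₁ : Fin m → ℕ) → (∀ x y → restrict A W x y ≡ true → c₁ x ≡ c₁ y → r₁ x < r₁ y) →
      ∀ c₂ (r₂ : Fin m → ℕ) → (∀ x y → restrict A (not ∘ W) x y ≡ true → c₂ x ≡ c₂ y → r₂ x < r₂ y) →
      (∃ λ s → ∀ u w → clash c₁ c₂ s u w ≡ false) → Col A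
    combine c₁ r₁ h₁ c₂ r₂ h₂ (s , good) = glue A W c₁ r₁ (rotate s ∘ c₂) r₂
      (λ x y a p q → h₁ x y (restrict-intro A W a p q))
      (λ x y a p q e → h₂ x y (restrict-intro A (not ∘ W) a (not-intro p) (not-intro q)) (rotate-injectiveʳ s e))
      (λ x y a p q e → true≢false
        (∧-intro (∧-intro p (∧-intro (not-intro q) a)) (dec-true (c₁ x ≟ rotate s (c₂ y)) e)) (good x y))

  arcs : Rel → ℕ
  arcs A = sum (deg A)

  arcs-⊂ : ∀ {A B} → B ⊆ A → ∀ u v → A u v ≡ true → B u v ≡ false → arcs B < arcs A
  arcs-⊂ {A} {B} s u v a b = sum-mono-< u (λ x → card-mono (s x)) (card-insert (B u) (A u) v b a (s u))

  -- Induction on the number of arcs: either a relation that misses an arc of A is still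
  -- uncolourable, and the search descends to it, or A itself is critical.
  critical-subdigraph : ∀ k A → arcs A ≤ k → Irreflexive A → ¬ Col A → ¬ ¬ ∃ λ B → B ⊆ A × Crit B
  critical-subdigraph k A bound irrA ¬c no-crit =
    em {∃ λ B → B ⊆ A × ¬ Col B × ∃ λ u → ∃ λ v → A u v ≡ true × B u v ≡ false} λ
      { (inj₁ (B , s , ¬cB , u , v , a , b)) → descend k bound B s ¬cB u v a b
      ; (inj₂ minimal) → no-crit (A , (λ _ _ p → p) , record
          { irr = irrA ; ¬col = ¬c
          ; crit = λ B s u v a b ¬cB → minimal (B , s , ¬cB , u , v , a , b) }) }
    where
    descend : ∀ k → arcs A ≤ k → ∀ B → B ⊆ A → ¬ Col B → ∀ u v → A u v ≡ true → B u v ≡ false → ⊥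
    descend zero bound B s ¬cB u v a b with ≤-trans (arcs-⊂ {A} {B} s u v a b) bound
    ... | ()
    descend (suc k) bound B s ¬cB u v a b =
      critical-subdigraph k B (≤-pred (≤-trans (arcs-⊂ {A} {B} s u v a b) bound))
        (λ w → false-intro λ t → true≢false (s w w t) (irrA w)) ¬cB
        λ { (D , t , CD) → no-crit (D , (λ x y p → s x y (t x y p)) , CD) }

-- For two identified vertices only the joint contribution can be compared. Moving the values at y
-- over to x gives a pointwise comparison that is an equality at y.
sum-mono-pair : ∀ {m} {f g : Fin m → ℕ} (x y : Fin m) → x ≢ y →
  (∀ u → u ≢ x → u ≢ y → f u ≤ g u) → f x + f y ≤ g x + g y → sum f ≤ sum g
sum-mono-pair {m} {f} {g} x y x≢y h hxy = +-cancelʳ-≤ (f y + g y) (sum f) (sum g) (begin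
    sum f + (f y + g y)                                               ≡⟨ sym (expand f (f y) (g y)) ⟩
    sum (λ u → f u + ([ u == x ] * f y + [ u == y ] * g y))           ≤⟨ sum-mono pointwise ⟩
    sum (λ u → g u + ([ u == x ] * g y + [ u == y ] * f y))           ≡⟨ expand g (g y) (f y) ⟩
    sum g + (g y + f y)                                               ≡⟨ cong (sum g +_) (+-comm (g y) (f y)) ⟩
    sum g + (f y + g y)                                               ∎)
  where
  open ≤-Reasoning
  expand : ∀ f a b → sum (λ u → f u + ([ u == x ] * a + [ u == y ] * b)) ≡ sum f + (a + b)
  expand f a b = trans (∑-distrib-+ {m} f _) (cong (sum f +_)
    (trans (∑-distrib-+ {m} _ _) (cong₂ _+_ (sum-point x a) (sum-point y b))))
  pointwise : ∀ u → f u + ([ u == x ] * f y + [ u == y ] * g y) ≤ g u + ([ u == x ] * g y + [ u == y ] * f y)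
  pointwise u with u ≟ x | u ≟ y
  ... | yes refl | yes refl = contradiction refl x≢y
  ... | yes refl | no _ rewrite +-identityʳ (f y) | +-identityʳ (g y) | +-identityʳ (f y) | +-identityʳ (g y) = hxy
  ... | no _ | yes refl rewrite +-identityʳ (f y) | +-identityʳ (g y) = ≤-reflexive (+-comm (f y) (g y))
  ... | no p | no q = +-monoˡ-≤ 0 (h u p q)

card-adjoin : ∀ {m} (P : Fin m → Bool) x → P x ≡ false → card (λ u → (u == x) ∨ P u) ≡ suc (card P)
card-adjoin {m} P x Px = trans (sum-cong-≗ pointwise) (trans (∑-distrib-+ {m} _ _) (cong (_+ card P) (sum-point₁ x)))
  where
  pointwise : ∀ u → [ (u == x) ∨ P u ] ≡ [ u == x ] + [ P u ]
  pointwise u with u ≟ x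
  ... | no _ = refl
  ... | yes refl rewrite Px = refl

-- Live vertices, excess and low vertices

module Counting (m N : ℕ) (0<N : 0 < N) where
  open Critical m N
  open Crit

  instance
    N≢0 : NonZero N
    N≢0 = ℕ.>-nonZero 0<N

  -- In a critical relation an incoming arc already forces outgoing ones, by `min-degree`, so these
  -- are exactly the non-isolated vertices.
  live : Rel → VSet
  live A u = does (1 ≤? deg A u)

  arc⇒live : ∀ {A} → Crit A → ∀ {u v} → A u v ≡ true → live A u ≡ true
  arc⇒live {A} C {u} {v} a = dec-true (1 ≤? deg A u) (≤-trans 0<N (min-degree C u v (inj₁ a)))

  arc⇒live′ : ∀ {A} → Crit A → ∀ {u v} → A u v ≡ true → live A v ≡ true
  arc⇒live′ {A} C {u} {v} a = dec-true (1 ≤? deg A v) (≤-trans 0<N (min-degree C v u (inj₂ a)))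

  live⇒arc : ∀ A u → live A u ≡ true → ∃ λ v → A u v ≡ true
  live⇒arc A u l = card-positive⇒∃ (A u) (does-elim (1 ≤? deg A u) l)

  live⇒degree : ∀ {A} → Crit A → ∀ u → live A u ≡ true → N ≤ deg A u
  live⇒degree {A} C u l with live⇒arc A u l
  ... | v , a = min-degree C u v (inj₁ a)

  ¬live⇒deg≡0 : ∀ A u → live A u ≡ false → deg A u ≡ 0
  ¬live⇒deg≡0 A u l = n<1⇒n≡0 (≰⇒> (does-elim-false (1 ≤? deg A u) l))

  ¬live⇒¬arc : ∀ A u → live A u ≡ false → ∀ v → A u v ≡ false
  ¬live⇒¬arc A u l v = false-intro λ a →
    does-elim-false (1 ≤? deg A u) l (≤-trans (≤-reflexive (sym ([true] a))) (term≤sum (λ v → [ A u v ]) v))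

  live-flip : ∀ {A} → Crit A → ∀ u → live A u ≡ true → live (flip A) u ≡ true
  live-flip {A} C u l with live⇒arc A u l
  ... | v , a = arc⇒live′ (Crit-flip C) a

  -- A live vertex has degree at least N, so truncation loses nothing there, and a dead vertex
  -- contributes zero to both sides.
  arcs≡excess+ : ∀ {A} → Crit A → arcs A ≡ excess A + N * card (live A)
  arcs≡excess+ {A} C = begin
      arcs A                                                   ≡⟨ sum-cong-≗ split ⟩
      sum (λ u → (deg A u ∸ N) + N * [ live A u ])             ≡⟨ ∑-distrib-+ {m} _ _ ⟩
      excess A + sum (λ u → N * [ live A u ])                  ≡⟨ cong (excess A +_) (sym (*-distribˡ-sum {m} N _)) ⟩
      excess A + N * card (live A)                             ∎
    where
    open ≡-Reasoning
    split : ∀ u → deg A u ≡ (deg A u ∸ N) + N * [ live A u ]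
    split u with bool-split (live A u)
    ... | inj₁ l = sym (trans (cong (λ t → (deg A u ∸ N) + N * t) ([true] l))
      (trans (cong ((deg A u ∸ N) +_) (*-identityʳ N)) (m∸n+n≡m (live⇒degree C u l))))
    ... | inj₂ l = sym (trans (cong₂ (λ s t → (s ∸ N) + N * t) (¬live⇒deg≡0 A u l) ([false] l))
      (trans (cong₂ _+_ (0∸n≡0 N) (*-zeroʳ N)) (sym (¬live⇒deg≡0 A u l))))

  -- Although defined through out-degrees, the excess depends only on the number of arcs and the set
  -- of live vertices, and reversal changes neither.
  excess-flip : ∀ {A} → Crit A → excess (flip A) ≡ excess A
  excess-flip {A} C = +-cancelʳ-≡ (N * card (live A)) _ _ (begin
      excess (flip A) + N * card (live A)         ≡⟨ cong (λ t → excess (flip A) + N * t) same ⟩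
      excess (flip A) + N * card (live (flip A))  ≡⟨ sym (arcs≡excess+ (Crit-flip C)) ⟩
      arcs (flip A)                               ≡⟨ ∑-comm {m} {m} (λ u v → [ A v u ]) ⟩
      arcs A                                      ≡⟨ arcs≡excess+ C ⟩
      excess A + N * card (live A)                ∎)
    where
    open ≡-Reasoning
    same : card (live A) ≡ card (live (flip A))
    same = ≤-antisym (card-mono (live-flip C)) (card-mono (live-flip (Crit-flip C)))

  arcsFrom : Rel → VSet → ℕ
  arcsFrom A W = sum λ u → [ W u ] * deg A u

  -- The accounting behind both reductions. The arcs of B and those leaving W all come out of W,
  -- except for s new ones; W has at most t vertices that B lost, each costing N, and the cut repays
  -- N.
  excess-compare : ∀ {A B} → Crit B → (W : VSet) → ∀ t s →
    arcs B + cutSize A W ≤ arcsFrom A W + s → N ≤ cutSize A W → card W ≤ card (live B) + t →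
    excess B + N ≤ excess A + N * t + s
  excess-compare {A} {B} CB W t s count N≤cut sizes = +-cancelʳ-≤ (N * L) _ _ (begin
      excess B + N + N * L                   ≡⟨ +-assoc (excess B) N (N * L) ⟩
      excess B + (N + N * L)                 ≡⟨ cong (excess B +_) (+-comm N (N * L)) ⟩
      excess B + (N * L + N)                 ≡⟨ sym (+-assoc (excess B) (N * L) N) ⟩
      excess B + N * L + N                   ≡⟨ cong (_+ N) (sym (arcs≡excess+ CB)) ⟩
      arcs B + N                             ≤⟨ +-monoʳ-≤ (arcs B) N≤cut ⟩
      arcs B + cutSize A W                   ≤⟨ count ⟩
      arcsFrom A W + s                       ≤⟨ +-monoˡ-≤ s from ⟩
      excess A + N * card W + s              ≤⟨ +-monoˡ-≤ s (+-monoʳ-≤ (excess A) (*-monoʳ-≤ N sizes)) ⟩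
      excess A + N * (L + t) + s             ≡⟨ cong (λ z → excess A + z + s) (trans (*-distribˡ-+ N L t) (+-comm (N * L) (N * t))) ⟩
      excess A + (N * t + N * L) + s         ≡⟨ cong (_+ s) (sym (+-assoc (excess A) (N * t) (N * L))) ⟩
      excess A + N * t + N * L + s           ≡⟨ +-assoc (excess A + N * t) (N * L) s ⟩
      excess A + N * t + (N * L + s)         ≡⟨ cong (excess A + N * t +_) (+-comm (N * L) s) ⟩
      excess A + N * t + (s + N * L)         ≡⟨ sym (+-assoc (excess A + N * t) s (N * L)) ⟩
      excess A + N * t + s + N * L           ∎)
    where
    open ≤-Reasoning
    L = card (live B)
    split : ∀ b d → [ b ] * d ≤ (d ∸ N) + N * [ b ]
    split true d = ≤-trans (≤-reflexive (+-identityʳ d)) (≤-trans (m≤n+m∸n d N)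
      (≤-reflexive (trans (+-comm N (d ∸ N)) (cong ((d ∸ N) +_) (sym (*-identityʳ N))))))
    split false d = z≤n
    from : arcsFrom A W ≤ excess A + N * card W
    from = begin
      arcsFrom A W                                   ≤⟨ sum-mono (λ u → split (W u) (deg A u)) ⟩
      sum (λ u → (deg A u ∸ N) + N * [ W u ])        ≡⟨ ∑-distrib-+ {m} _ _ ⟩
      excess A + sum (λ u → N * [ W u ])             ≡⟨ cong (excess A +_) (sym (*-distribˡ-sum {m} N _)) ⟩
      excess A + N * card W                          ∎

  low : Rel → VSet
  low A u = does (deg A u ℕ.≟ N)

  low⇒deg : ∀ A u → low A u ≡ true → deg A u ≡ N
  low⇒deg A u = does-elim (deg A u ℕ.≟ N)

  -- Each vertex of P that is not low contributes at least one to the excess.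
  card-low : ∀ {A} (P : VSet) → (∀ u → P u ≡ true → N ≤ deg A u) →
    card P ≤ card (λ u → P u ∧ low A u) + excess A
  card-low {A} P h = ≤-trans (sum-mono pointwise) (≤-reflexive (∑-distrib-+ {m} _ _))
    where
    pointwise : ∀ u → [ P u ] ≤ [ P u ∧ low A u ] + (deg A u ∸ N)
    pointwise u = []≤ (P u) λ p → high u p
      where
      high : ∀ u → P u ≡ true → 1 ≤ [ P u ∧ low A u ] + (deg A u ∸ N)
      high u p with bool-split (low A u)
      ... | inj₁ l = ≤-trans (≤-reflexive (sym ([true] (∧-intro p l)))) (m≤m+n _ _)
      ... | inj₂ l = ≤-trans (m<n⇒0<n∸m (≤∧≢⇒< (h u p) (does-elim-false (deg A u ℕ.≟ N) l ∘ sym))) (m≤n+m _ _)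

  -- The assumption `excess A + 2 < N` is the negation of the bound to be proved; it leaves at most
  -- N - 3 vertices of P that are not low.
  many-low : ∀ {A} (P : VSet) → N ≤ card P → (∀ u → P u ≡ true → N ≤ deg A u) → excess A + 2 < N →
    3 ≤ card (λ u → P u ∧ low A u)
  many-low {A} P N≤P h small = +-cancelʳ-≤ (excess A) 3 _ (begin
      3 + excess A                                      ≡⟨ cong suc (+-comm 2 (excess A)) ⟩
      suc (excess A + 2)                                ≤⟨ small ⟩
      N                                                 ≤⟨ N≤P ⟩
      card P                                            ≤⟨ card-low P h ⟩
      card (λ u → P u ∧ low A u) + excess A             ∎)
    where open ≤-Reasoning

  some-arc : ∀ {B} → ¬ Col B → ∃ λ u → ∃ λ w → B u w ≡ true
  some-arc {B} ¬c with any? (λ u → any? λ w → B u w Bool.≟ true)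
  ... | yes p = p
  ... | no none = ⊥-elim (¬c ((λ _ → fromℕ< 0<N) , (λ _ → 0) , λ u w b → ⊥-elim (none (u , w , b))))

  IsClique : Rel → VSet → Set
  IsClique A Q = ∀ u v → Q u ≡ true → Q v ≡ true → u ≢ v → A u v ≡ true

  Free : Rel → Set
  Free A = ¬ ∃ λ Q → card Q ≡ suc N × IsClique A Q

-- Identification of two vertices

module Merging (m N : ℕ) (0<N : 0 < N) where
  open Critical m N
  open Crit
  open Counting m N 0<N

  -- What remains visible in A when identifying x and y yields a complete digraph on N + 1 vertices:
  -- Q is that clique without the identified vertex. The last two fields hold because a low vertex
  -- joined to both x and y in one direction loses an arc and drops below degree N.
  record Fork (A : Rel) (x y : Fin m) : Set where
    field
      Q      : VSet
      size   : card Q ≡ N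
      clique : IsClique A Q
      x∉     : Q x ≡ false
      y∉     : Q y ≡ false
      out    : ∀ q → Q q ≡ true → A q x ≡ true ⊎ A q y ≡ true
      into   : ∀ q → Q q ≡ true → A x q ≡ true ⊎ A y q ≡ true
      notLow : ∀ q → Q q ≡ true → deg A q ≡ N → A q x ≡ true → A q y ≡ true → ⊥
      notLow⁻ : ∀ q → Q q ≡ true → deg (flip A) q ≡ N → A x q ≡ true → A y q ≡ true → ⊥
  open Fork

  Fork-flip : ∀ {A x y} → Fork A x y → Fork (flip A) x y
  Fork-flip F = record
    { Q = Q F ; size = size F ; clique = λ u v p q e → clique F v u q p (e ∘ sym)
    ; x∉ = x∉ F ; y∉ = y∉ F ; out = into F ; into = out F ; notLow = notLow⁻ F ; notLow⁻ = notLow F }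

  Fork-swap : ∀ {A x y} → Fork A x y → Fork A y x
  Fork-swap F = record
    { Q = Q F ; size = size F ; clique = clique F ; x∉ = y∉ F ; y∉ = x∉ F
    ; out = λ q p → Sum.swap (out F q p) ; into = λ q p → Sum.swap (into F q p)
    ; notLow = λ q p l a b → notLow F q p l b a ; notLow⁻ = λ q p l a b → notLow⁻ F q p l b a }

  module _ {A : Rel} (C : Crit A) (free : Free A) (x y v : Fin m) (x≢y : x ≢ y) (y↛x : A y x ≡ false)
           (v→x : A v x ≡ true) (v→y : A v y ≡ true) (v-low : deg A v ≡ N) where

    -- The vertex set is kept: x plays the identified vertex and y becomes isolated. An arc from x
    -- to y may exist; it would become a loop and is dropped.
    merged : Rel
    merged u w = not (u == y) ∧ (not (w == y) ∧ (not (u == w) ∧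
      (A u w ∨ (((u == x) ∧ A y w) ∨ ((w == x) ∧ A u y)))))

    Origin : Fin m → Fin m → Set
    Origin u w = A u w ≡ true ⊎ (u ≡ x × A y w ≡ true) ⊎ (w ≡ x × A u y ≡ true)

    merged-elim : ∀ u w → merged u w ≡ true → u ≢ y × w ≢ y × u ≢ w × Origin u w
    merged-elim u w a with ∧-elim a
    ... | p , a with ∧-elim a
    ... | q , a with ∧-elim a
    ... | r , a = ==⇒≢ u y (not-elim p) , ==⇒≢ w y (not-elim q) , ==⇒≢ u w (not-elim r) , origin (∨-elim a)
      where
      origin : A u w ≡ true ⊎ ((u == x) ∧ A y w) ∨ ((w == x) ∧ A u y) ≡ true → Origin u w
      origin (inj₁ a) = inj₁ a
      origin (inj₂ a) with ∨-elim {(u == x) ∧ A y w} a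
      ... | inj₁ b = inj₂ (inj₁ (==⇒≡ u x (proj₁ (∧-elim b)) , proj₂ (∧-elim {u == x} b)))
      ... | inj₂ b = inj₂ (inj₂ (==⇒≡ w x (proj₁ (∧-elim b)) , proj₂ (∧-elim {w == x} b)))

    merged-intro : ∀ {u w} → u ≢ y → w ≢ y → u ≢ w → Origin u w → merged u w ≡ true
    merged-intro {u} {w} p q r o = ∧-intro (not-intro (≢⇒== p)) (∧-intro (not-intro (≢⇒== q))
        (∧-intro (not-intro (≢⇒== r)) (origin o)))
      where
      origin : Origin u w → A u w ∨ (((u == x) ∧ A y w) ∨ ((w == x) ∧ A u y)) ≡ true
      origin (inj₁ a) = ∨-introˡ a
      origin (inj₂ (inj₁ (refl , a))) = ∨-introʳ {A u w} (∨-introˡ (∧-intro (==-refl u) a))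
      origin (inj₂ (inj₂ (refl , a))) = ∨-introʳ {A u w} (∨-introʳ {(u == x) ∧ A y w} (∧-intro (==-refl w) a))

    merged-irr : Irreflexive merged
    merged-irr u = false-intro λ t → proj₁ (proj₂ (proj₂ (merged-elim u u t))) refl

    -- Doubling the ranks makes room to place y just above x.
    unmerge : Col merged → Col A
    unmerge (c , r , h) = c′ , r′ , ok
      where
      c′ : Fin m → Fin N
      c′ u = if u == y then c x else c u
      r′ : Fin m → ℕ
      r′ u = if u == y then suc (r x + r x) else r u + r u
      at-y : ∀ {u} → u == y ≡ true → c′ u ≡ c x × r′ u ≡ suc (r x + r x)
      at-y p = if-true p , if-true p
      off-y : ∀ {u} → u == y ≡ false → c′ u ≡ c u × r′ u ≡ r u + r u
      off-y p = if-false p , if-false p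
      double-< : ∀ {a b} → a < b → suc (a + a) < b + b
      double-< {a} {b} a<b = ≤-trans (≤-reflexive (cong suc (sym (+-suc a a)))) (+-mono-≤ a<b a<b)
      ok : ∀ u w → A u w ≡ true → c′ u ≡ c′ w → r′ u < r′ w
      ok u w a e with bool-split (u == y) | bool-split (w == y)
      ... | inj₁ p | inj₁ q = contradiction (trans (==⇒≡ u y p) (sym (==⇒≡ w y q))) (arc⇒≢ C a)
      ... | inj₁ p | inj₂ q = subst₂ _<_ (sym (proj₂ (at-y p))) (sym (proj₂ (off-y q)))
        (double-< (h x w (merged-intro x≢y (==⇒≢ w y q) x≢w (inj₂ (inj₁ (refl , y→w))))
          (trans (sym (proj₁ (at-y p))) (trans e (proj₁ (off-y q))))))
        where
        y→w : A y w ≡ true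
        y→w = subst (λ z → A z w ≡ true) (==⇒≡ u y p) a
        -- Here the absence of an arc from y to x is essential: y is ranked above x.
        x≢w : x ≢ w
        x≢w refl = true≢false y→w y↛x
      ... | inj₂ p | inj₁ q with bool-split (u == x)
      ...   | inj₁ s = subst₂ _<_ (sym (trans (proj₂ (off-y p)) (cong (λ z → r z + r z) (==⇒≡ u x s))))
        (sym (proj₂ (at-y q))) ≤-refl
      ...   | inj₂ s = subst₂ _<_ (sym (proj₂ (off-y p))) (sym (proj₂ (at-y q)))
        (<-trans (n<1+n _) (<-trans (double-< (h u x (merged-intro (==⇒≢ u y p) x≢y (==⇒≢ u x s)
            (inj₂ (inj₂ (refl , subst (λ z → A u z ≡ true) (==⇒≡ w y q) a))))
          (trans (sym (proj₁ (off-y p))) (trans e (proj₁ (at-y q)))))) (n<1+n _)))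
      ok u w a e | inj₂ p | inj₂ q = subst₂ _<_ (sym (proj₂ (off-y p))) (sym (proj₂ (off-y q)))
        (<-trans (n<1+n _) (double-< (h u w (merged-intro (==⇒≢ u y p) (==⇒≢ w y q) (arc⇒≢ C a) (inj₁ a))
          (trans (sym (proj₁ (off-y p))) (trans e (proj₁ (off-y q)))))))

    -- The arcs from u to x and to y collapse into one.
    deg-merged< : ∀ u → A u x ≡ true → A u y ≡ true → deg merged u < deg A u
    deg-merged< u u→x u→y = card-insert (merged u) (A u) y
      (false-intro λ t → proj₁ (proj₂ (merged-elim u y t)) refl) u→y λ w t → origin w (proj₂ (proj₂ (proj₂ (merged-elim u w t))))
      where
      origin : ∀ w → Origin u w → A u w ≡ true
      origin w (inj₁ a) = a
      origin w (inj₂ (inj₁ (u≡x , _))) = contradiction u≡x (arc⇒≢ C u→x)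
      origin w (inj₂ (inj₂ (w≡x , _))) = subst (λ z → A u z ≡ true) (sym w≡x) u→x

    deg⁻-merged< : ∀ u → A x u ≡ true → A y u ≡ true → deg (flip merged) u < deg (flip A) u
    deg⁻-merged< u x→u y→u = card-insert (flip merged u) (flip A u) y
      (false-intro λ t → proj₁ (merged-elim y u t) refl) y→u λ w t → origin w (proj₂ (proj₂ (proj₂ (merged-elim w u t))))
      where
      origin : ∀ w → Origin w u → A w u ≡ true
      origin w (inj₁ a) = a
      origin w (inj₂ (inj₁ (w≡x , _))) = subst (λ z → A z u ≡ true) (sym w≡x) x→u
      origin w (inj₂ (inj₂ (u≡x , _))) = contradiction (sym u≡x) (arc⇒≢ C x→u)

    module _ {B : Rel} (CB : Crit B) (B⊆M : B ⊆ merged) where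

      B-elim : ∀ {u w} → B u w ≡ true → u ≢ y × w ≢ y × u ≢ w × Origin u w
      B-elim {u} {w} b = merged-elim u w (B⊆M u w b)

      B-off-x : ∀ {u w} → B u w ≡ true → u ≢ x → w ≢ x → A u w ≡ true
      B-off-x b u≢x w≢x with proj₂ (proj₂ (proj₂ (B-elim b)))
      ... | inj₁ a = a
      ... | inj₂ (inj₁ (e , _)) = contradiction e u≢x
      ... | inj₂ (inj₂ (e , _)) = contradiction e w≢x

      B-from-x : ∀ {w} → B x w ≡ true → A x w ≡ true ⊎ A y w ≡ true
      B-from-x b with proj₂ (proj₂ (proj₂ (B-elim b)))
      ... | inj₁ a = inj₁ a
      ... | inj₂ (inj₁ (_ , a)) = inj₂ a
      ... | inj₂ (inj₂ (e , _)) = contradiction (sym e) (arc⇒≢ CB b)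

      B-to-x : ∀ {u} → B u x ≡ true → A u x ≡ true ⊎ A u y ≡ true
      B-to-x b with proj₂ (proj₂ (proj₂ (B-elim b)))
      ... | inj₁ a = inj₁ a
      ... | inj₂ (inj₁ (e , _)) = contradiction e (arc⇒≢ CB b)
      ... | inj₂ (inj₂ (_ , a)) = inj₂ a

      -- After the identification u has fewer than N out-neighbours, too few for a live vertex of a
      -- critical relation.
      low-dies : ∀ u → deg A u ≡ N → A u x ≡ true → A u y ≡ true → live B u ≡ false
      low-dies u l a b = false-intro λ t → <⇒≱ (≤-trans (deg-merged< u a b) (≤-reflexive l))
        (≤-trans (live⇒degree CB u t) (card-mono (B⊆M u)))

      low⁻-dies : ∀ u → deg (flip A) u ≡ N → A x u ≡ true → A y u ≡ true → live B u ≡ false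
      low⁻-dies u l a b = false-intro λ t → <⇒≱ (≤-trans (deg⁻-merged< u a b) (≤-reflexive l))
        (≤-trans (live⇒degree (Crit-flip CB) u (live-flip CB u t)) (card-mono λ w → B⊆M w u))

      v-dead : live B v ≡ false
      v-dead = low-dies v v-low v→x v→y

      -- If x were dead, B would consist of arcs of A and miss the arc from v to x, so criticality
      -- of A would make it colourable.
      x-live : live B x ≡ true
      x-live with bool-split (live B x)
      ... | inj₁ l = l
      ... | inj₂ l = ⊥-elim (crit C B (λ u w b → B-off-x b (λ { refl → true≢false (arc⇒live CB b) l })
          (λ { refl → true≢false (arc⇒live′ CB b) l })) v x v→x (¬live⇒¬arc B v v-dead x) (¬col CB))

      y-dead : live B y ≡ false
      y-dead = false-intro λ l → proj₁ (B-elim (proj₂ (live⇒arc B y l))) refl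

      -- The preimage of the live vertices of B under the identification; this is the set whose
      -- outgoing cut is taken in A.
      W : VSet
      W u = (u == y) ∨ live B u

      W-y : W y ≡ true
      W-y = ∨-introˡ (==-refl y)

      live⇒W : ∀ u → live B u ≡ true → W u ≡ true
      live⇒W u l = ∨-introʳ {u == y} l

      W-x : W x ≡ true
      W-x = live⇒W x x-live

      leaving : Fin m → Fin m → Bool
      leaving u w = W u ∧ (not (W w) ∧ A u w)

      leaving⇒A : ∀ {u w} → leaving u w ≡ true → A u w ≡ true
      leaving⇒A {u} {w} t = proj₂ (∧-elim {not (W w)} (proj₂ (∧-elim {W u} t)))

      leaving⇒∉ : ∀ {u w} → leaving u w ≡ true → W w ≡ false
      leaving⇒∉ {u} {w} t = not-elim (proj₁ (∧-elim {not (W w)} (proj₂ (∧-elim {W u} t))))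

      ¬leaving : ∀ u {w} → W w ≡ true → [ leaving u w ] ≡ 0
      ¬leaving u Ww = [false] (false-intro λ t → true≢false Ww (leaving⇒∉ {u} t))

      B-not-leaving : ∀ {u w z} → B u w ≡ true → leaving z w ≡ true → ⊥
      B-not-leaving {u} {w} {z} b t = true≢false (live⇒W w (arc⇒live′ CB b)) (leaving⇒∉ {z} t)

      -- Arcs of B end in W and leaving arcs do not, so they are disjoint. An arc of B to x may stem
      -- from one to x or to y, whence the joint treatment of these two columns.
      row : ∀ u → u ≢ x → u ≢ y → deg B u + card (leaving u) ≤ [ W u ] * deg A u
      row u u≢x u≢y with bool-split (live B u)
      ... | inj₂ l = ≤-trans (≤-reflexive (cong₂ _+_ (¬live⇒deg≡0 B u l)
          (sum-zero (λ w → [ leaving u w ]) λ w → [false] (cong (_∧ (not (W w) ∧ A u w)) (cong₂ _∨_ (≢⇒== u≢y) l))))) z≤n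
      ... | inj₁ l = begin
          deg B u + card (leaving u)                 ≡⟨ sym (∑-distrib-+ {m} _ _) ⟩
          sum (λ w → [ B u w ] + [ leaving u w ])    ≤⟨ sum-mono-pair x y x≢y off on ⟩
          deg A u                                    ≡⟨ sym (+-identityʳ _) ⟩
          1 * deg A u                                ≡⟨ cong (_* deg A u) (sym ([true] (live⇒W u l))) ⟩
          [ W u ] * deg A u                          ∎
        where
        open ≤-Reasoning
        off : ∀ w → w ≢ x → w ≢ y → [ B u w ] + [ leaving u w ] ≤ [ A u w ]
        off w w≢x w≢y = []+[]≤ (B u w) (leaving u w) (λ b → []≥1 (B-off-x b u≢x w≢x)) (λ t → []≥1 (leaving⇒A {u} t))
          (λ b t → ⊥-elim (B-not-leaving {z = u} b t))
        on : ([ B u x ] + [ leaving u x ]) + ([ B u y ] + [ leaving u y ]) ≤ [ A u x ] + [ A u y ]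
        on rewrite ¬leaving u W-x | ¬leaving u W-y | [false] {B u y} (false-intro λ b → proj₁ (proj₂ (B-elim b)) refl)
          | +-identityʳ ([ B u x ] + 0) | +-identityʳ [ B u x ] = []≤ (B u x) λ b → either (B-to-x b)
          where
          either : A u x ≡ true ⊎ A u y ≡ true → 1 ≤ [ A u x ] + [ A u y ]
          either (inj₁ a) = ≤-trans ([]≥1 a) (m≤m+n _ _)
          either (inj₂ a) = ≤-trans ([]≥1 a) (m≤n+m _ _)

      -- An arc of B from x to w stems from an arc of A from x or from y, and as w is then in W,
      -- neither x nor y has a leaving arc to w.
      rows : (deg B x + card (leaving x)) + (deg B y + card (leaving y)) ≤ [ W x ] * deg A x + [ W y ] * deg A y
      rows = begin
          (deg B x + card (leaving x)) + (deg B y + card (leaving y))           ≡⟨ cong (λ t → (deg B x + card (leaving x)) + (t + card (leaving y))) (¬live⇒deg≡0 B y y-dead) ⟩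
          (deg B x + card (leaving x)) + card (leaving y)                       ≡⟨ cong (_+ card (leaving y)) (sym (∑-distrib-+ {m} _ _)) ⟩
          sum (λ w → [ B x w ] + [ leaving x w ]) + card (leaving y)            ≡⟨ sym (∑-distrib-+ {m} _ _) ⟩
          sum (λ w → [ B x w ] + [ leaving x w ] + [ leaving y w ])             ≤⟨ sum-mono pointwise ⟩
          sum (λ w → [ A x w ] + [ A y w ])                                     ≡⟨ ∑-distrib-+ {m} _ _ ⟩
          deg A x + deg A y                                                     ≡⟨ sym (cong₂ _+_ (full W-x (deg A x)) (full W-y (deg A y))) ⟩
          [ W x ] * deg A x + [ W y ] * deg A y                                 ∎
        where
        open ≤-Reasoning
        full : ∀ {b} → b ≡ true → ∀ d → [ b ] * d ≡ d
        full p d = trans (cong (_* d) ([true] p)) (*-identityˡ d)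
        either : ∀ w → A x w ≡ true ⊎ A y w ≡ true → 1 ≤ [ A x w ] + [ A y w ]
        either w (inj₁ a) = ≤-trans ([]≥1 a) (m≤m+n _ _)
        either w (inj₂ a) = ≤-trans ([]≥1 a) (m≤n+m _ _)
        pointwise : ∀ w → [ B x w ] + [ leaving x w ] + [ leaving y w ] ≤ [ A x w ] + [ A y w ]
        pointwise w with bool-split (B x w)
        ... | inj₁ b rewrite ¬leaving x (live⇒W w (arc⇒live′ CB b)) | ¬leaving y (live⇒W w (arc⇒live′ CB b))
                           | +-identityʳ ([ B x w ] + 0) | +-identityʳ [ B x w ] = []≤ (B x w) λ b → either w (B-from-x b)
        ... | inj₂ b rewrite b = +-mono-≤ ([]-mono (leaving⇒A {x})) ([]-mono (leaving⇒A {y}))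

      -- Only y is lost and no arc is new, so t = 1 and s = 0, and the cut pays exactly for y. The
      -- arc from the dead vertex v to x supplies the tail outside W that `cut` requires.
      merged-excess : excess B ≤ excess A
      merged-excess = +-cancelʳ-≤ N (excess B) (excess A) (≤-trans
          (excess-compare CB W 1 0 count (cut C W (proj₂ x-arc) W-x v→x v∉W) sizes)
          (≤-reflexive (trans (+-identityʳ _) (cong (excess A +_) (*-identityʳ N)))))
        where
        x-arc : ∃ λ w → A x w ≡ true
        x-arc = live⇒arc A x (arc⇒live′ C v→x)
        v∉W : W v ≡ false
        v∉W = cong₂ _∨_ (≢⇒== (arc⇒≢ C v→y)) v-dead
        count : arcs B + cutSize A W ≤ arcsFrom A W + 0
        count = ≤-trans (≤-trans (≤-reflexive (sym (∑-distrib-+ {m} (deg B) (λ u → card (leaving u)))))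
          (sum-mono-pair x y x≢y row rows)) (≤-reflexive (sym (+-identityʳ _)))
        sizes : card W ≤ card (live B) + 1
        sizes = ≤-reflexive (trans (card-adjoin (live B) y y-dead) (+-comm 1 _))

      fewer-live : card (live B) < card (live A)
      fewer-live = card-insert (live B) (live A) y y-dead (arc⇒live′ C v→y) λ u l → alive u (live⇒arc B u l)
        where
        alive : ∀ u → (∃ λ w → B u w ≡ true) → live A u ≡ true
        alive u (w , b) with proj₂ (proj₂ (proj₂ (B-elim b)))
        ... | inj₁ a = arc⇒live C a
        ... | inj₂ (inj₁ (refl , _)) = arc⇒live′ C v→x
        ... | inj₂ (inj₂ (_ , a)) = arc⇒live C a

      -- Vertices of the clique are live in B, whereas `low-dies` and `low⁻-dies` kill low vertices
      -- joined to both x and y; hence the last two fields.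
      clique⇒Fork : (∃ λ Q → card Q ≡ suc N × IsClique B Q) → Fork A x y
      clique⇒Fork (Q , size , clique) = record
          { Q = Q′
          ; size = suc-injective (trans (card-remove Q x x∈Q) size)
          ; clique = λ u w p q u≢w → B-off-x (clique u w (in-Q p) (in-Q q) u≢w) (off-x p) (off-x q)
          ; x∉ = false-intro λ p → off-x p refl
          ; y∉ = false-intro λ p → proj₁ (B-elim (clique y x (in-Q p) x∈Q (off-x p))) refl
          ; out = λ q p → B-to-x (to p)
          ; into = λ q p → B-from-x (from p)
          ; notLow = λ q p l a b → true≢false (arc⇒live CB (to p)) (low-dies q l a b)
          ; notLow⁻ = λ q p l a b → true≢false (arc⇒live CB (to p)) (low⁻-dies q l a b)
          }
        where
        Q′ : VSet
        Q′ u = Q u ∧ not (u == x)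
        in-Q : ∀ {u} → Q′ u ≡ true → Q u ≡ true
        in-Q = proj₁ ∘ ∧-elim
        off-x : ∀ {u} → Q′ u ≡ true → u ≢ x
        off-x {u} p = ==⇒≢ u x (not-elim (proj₂ (∧-elim {Q u} p)))
        x∈Q : Q x ≡ true
        x∈Q with bool-split (Q x)
        ... | inj₁ p = p
        -- A clique avoiding x would consist of arcs of A, against `free`.
        ... | inj₂ p = ⊥-elim (free (Q , size , λ u w Qu Qw u≢w → B-off-x (clique u w Qu Qw u≢w)
          (λ { refl → true≢false Qu p }) (λ { refl → true≢false Qw p })))
        to : ∀ {q} → Q′ q ≡ true → B q x ≡ true
        to p = clique _ x (in-Q p) x∈Q (off-x p)
        from : ∀ {q} → Q′ q ≡ true → B x q ≡ true
        from p = clique x _ x∈Q (in-Q p) (off-x p ∘ sym)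

    -- Without a fork, B has no clique of size N + 1, so induction bounds its excess from below, and
    -- `merged-excess` passes the bound on to A.
    merge : (∀ B → card (live B) < card (live A) → Crit B → Free B → N ≤ excess B + 2) → excess A + 2 < N →
      ¬ ¬ Fork A x y
    merge ih small no-fork = critical-subdigraph (arcs merged) merged ≤-refl merged-irr (¬col C ∘ unmerge)
      λ { (B , B⊆M , CB) → <⇒≱ small (≤-trans
        (ih B (fewer-live CB B⊆M) CB (λ k → no-fork (clique⇒Fork CB B⊆M k)))
        (+-monoˡ-≤ 2 (merged-excess CB B⊆M))) }

-- Rainbow colourings of a clique

module Greedy (m N : ℕ) (bad : Fin m → Fin N → Bool) (e : Fin m → ℕ)
              (q q′ : Fin m) (q≢q′ : q ≢ q′) (a b : Fin N) (a≢b : a ≢ b) where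

  Domain : (Fin m → Bool) → Fin m → Set
  Domain P u = P u ≡ true ⊎ u ≡ q ⊎ u ≡ q′

  record Assignment (P : Fin m → Bool) (F : Fin N → Bool) : Set where
    field
      π         : Fin m → Fin N
      good      : ∀ u → P u ≡ true → bad u (π u) ≡ false
      πq≢a      : π q ≢ a
      πq′≢b     : π q′ ≢ b
      free      : ∀ u → Domain P u → F (π u) ≡ true
      injective : ∀ u w → Domain P u → Domain P w → π u ≡ π w → u ≡ w
  open Assignment

  assign-two : ∀ P F g g′ → (∀ u → P u ≡ true → ⊥) → F g ≡ true → F g′ ≡ true → g ≢ g′ → g ≢ a → g′ ≢ b →
    Assignment P F
  assign-two P F g g′ empty Fg Fg′ g≢g′ g≢a g′≢b = record
      { π = π₀
      ; good = λ u p → ⊥-elim (empty u p)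
      ; πq≢a = λ t → g≢a (trans (sym at-q) t)
      ; πq′≢b = λ t → g′≢b (trans (sym at-q′) t)
      ; free = λ { u (inj₁ p) → ⊥-elim (empty u p)
                 ; u (inj₂ (inj₁ refl)) → trans (cong F at-q) Fg
                 ; u (inj₂ (inj₂ refl)) → trans (cong F at-q′) Fg′ }
      ; injective = inj }
    where
    π₀ : Fin m → Fin N
    π₀ w = if w == q then g else g′
    at-q : π₀ q ≡ g
    at-q = if-true (==-refl q)
    at-q′ : π₀ q′ ≡ g′
    at-q′ = if-false (≢⇒== (q≢q′ ∘ sym))
    inj : ∀ u w → Domain P u → Domain P w → π₀ u ≡ π₀ w → u ≡ w
    inj u w (inj₁ p) _ t = ⊥-elim (empty u p)
    inj u w _ (inj₁ p) t = ⊥-elim (empty w p)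
    inj u w (inj₂ (inj₁ refl)) (inj₂ (inj₁ refl)) t = refl
    inj u w (inj₂ (inj₂ refl)) (inj₂ (inj₂ refl)) t = refl
    inj u w (inj₂ (inj₁ refl)) (inj₂ (inj₂ refl)) t = contradiction (trans (sym at-q) (trans t at-q′)) g≢g′
    inj u w (inj₂ (inj₂ refl)) (inj₂ (inj₁ refl)) t = contradiction (trans (sym at-q) (trans (sym t) at-q′)) g≢g′

  assign-step : ∀ P F u j → P u ≡ true → P q ≡ false → P q′ ≡ false → F j ≡ true → bad u j ≡ false →
    Assignment (λ w → P w ∧ not (w == u)) (λ i → F i ∧ not (i == j)) → Assignment P F
  assign-step P F u j Pu Pq Pq′ Fj ok S = record
      { π = π₁
      ; good = good₁
      ; πq≢a = λ t → πq≢a S (trans (sym (off q≢u)) t)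
      ; πq′≢b = λ t → πq′≢b S (trans (sym (off q′≢u)) t)
      ; free = free₁
      ; injective = inj₁′ }
    where
    π₁ : Fin m → Fin N
    π₁ w = if w == u then j else π S w
    off : ∀ {w} → w ≢ u → π₁ w ≡ π S w
    off w≢u = if-false (≢⇒== w≢u)
    q≢u : q ≢ u
    q≢u refl = true≢false Pu Pq
    q′≢u : q′ ≢ u
    q′≢u refl = true≢false Pu Pq′
    good₁ : ∀ w → P w ≡ true → bad w (π₁ w) ≡ false
    good₁ w p with w ≟ u
    ... | yes refl = ok
    ... | no w≢u = good S w (∧-intro p (not-intro (≢⇒== w≢u)))
    sub : ∀ w → w ≢ u → Domain P w → Domain (λ w → P w ∧ not (w == u)) w
    sub w w≢u (inj₁ p) = inj₁ (∧-intro p (not-intro (≢⇒== w≢u)))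
    sub w w≢u (inj₂ d) = inj₂ d
    free₁ : ∀ w → Domain P w → F (π₁ w) ≡ true
    free₁ w d with w ≟ u
    ... | yes refl = Fj
    ... | no w≢u = proj₁ (∧-elim (free S w (sub w w≢u d)))
    avoid : ∀ w → w ≢ u → Domain P w → π S w ≢ j
    avoid w w≢u d = ==⇒≢ _ j (not-elim (proj₂ (∧-elim {F (π S w)} (free S w (sub w w≢u d)))))
    inj₁′ : ∀ v w → Domain P v → Domain P w → π₁ v ≡ π₁ w → v ≡ w
    inj₁′ v w dv dw t with v ≟ u | w ≟ u
    ... | yes refl | yes refl = refl
    ... | yes refl | no w≢u = contradiction (sym t) (avoid w w≢u dw)
    ... | no v≢u | yes refl = contradiction t (avoid v v≢u dv)
    ... | no v≢u | no w≢u = injective S v w (sub v v≢u dv) (sub w w≢u dw) t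

  weight : (Fin m → Bool) → ℕ
  weight P = sum λ u → [ P u ] * e u

  weight-remove : ∀ P u → P u ≡ true → weight (λ w → P w ∧ not (w == u)) + e u ≡ weight P
  weight-remove P u Pu = begin
      weight (λ w → P w ∧ not (w == u)) + e u                                ≡⟨ cong (weight (λ w → P w ∧ not (w == u)) +_) (sym (sum-point u (e u))) ⟩
      weight (λ w → P w ∧ not (w == u)) + sum (λ w → [ w == u ] * e u)       ≡⟨ sym (∑-distrib-+ {m} _ _) ⟩
      sum (λ w → [ P w ∧ not (w == u) ] * e w + [ w == u ] * e u)            ≡⟨ sum-cong-≗ pointwise ⟩
      weight P                                                               ∎
    where
    open ≡-Reasoning
    pointwise : ∀ w → [ P w ∧ not (w == u) ] * e w + [ w == u ] * e u ≡ [ P w ] * e w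
    pointwise w with w ≟ u
    ... | yes refl rewrite Pu = refl
    ... | no _ rewrite Bool.∧-identityʳ (P w) = +-identityʳ _

  -- Rows with many forbidden colours are served first; q and q′ share the last two colours.
  assign : ∀ k P F → P q ≡ false → P q′ ≡ false → card P ≡ k → card F ≡ 2 + k →
    (∀ u → P u ≡ true → card (bad u) ≤ suc (e u)) → weight P ≤ k ∸ 1 → Assignment P F
  assign zero P F Pq Pq′ sizeP sizeF few light with card-positive⇒∃ F (≤-trans (s≤s z≤n) (≤-reflexive (sym sizeF)))
  ... | g , Fg with ∃-other F g (≤-reflexive (sym sizeF))
  ... | g′ , Fg′ , g′≢g = choose (g ≟ a) (g′ ≟ b)
    where
    empty : ∀ u → P u ≡ true → ⊥
    empty u p = <⇒≱ (≤-trans (≤-reflexive (sym ([true] p))) (term≤sum (λ u → [ P u ]) u)) (≤-reflexive sizeP)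
    -- If one order of the last two colours fails, the other works, because a and b differ.
    choose : Dec (g ≡ a) → Dec (g′ ≡ b) → Assignment P F
    choose (no g≢a) (no g′≢b) = assign-two P F g g′ empty Fg Fg′ (g′≢g ∘ sym) g≢a g′≢b
    choose (yes refl) _ = assign-two P F g′ g empty Fg′ Fg g′≢g g′≢g a≢b
    choose (no _) (yes refl) = assign-two P F g′ g empty Fg′ Fg g′≢g (a≢b ∘ sym) (g′≢g ∘ sym)
  assign (suc k) P F Pq Pq′ sizeP sizeF few light = go heaviest
    where
    Choice : Set
    Choice = ∃ λ u → P u ≡ true × weight (λ w → P w ∧ not (w == u)) ≤ k ∸ 1
    -- Serving a vertex of positive weight lowers the total by at least one, in step with the
    -- budget; if there is none, the total is zero.
    heaviest : Choice
    heaviest with any? (λ u → (P u Bool.≟ true) ×-dec (1 ≤? e u))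
    ... | yes (u , p , heavy) = u , p , ≤-trans
      (∸-monoˡ-≤ 1 (≤-trans (≤-reflexive (+-comm 1 _)) (≤-trans (+-monoʳ-≤ _ heavy) (≤-trans (≤-reflexive (weight-remove P u p)) light)))) ≤-refl
    ... | no none with card-positive⇒∃ P (≤-trans (s≤s z≤n) (≤-reflexive (sym sizeP)))
    ...   | u , p = u , p , ≤-trans (≤-reflexive (sum-zero _ λ w → weightless w)) z≤n
      where
      weightless : ∀ w → [ P w ∧ not (w == u) ] * e w ≡ 0
      weightless w with bool-split (P w)
      ... | inj₂ p = cong (_* e w) ([false] (cong (_∧ not (w == u)) p))
      ... | inj₁ p = trans (cong ([ P w ∧ not (w == u) ] *_) (n<1⇒n≡0 (≰⇒> λ h → none (w , p , h)))) (*-zeroʳ [ P w ∧ not (w == u) ])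
    go : Choice → Assignment P F
    go (u , p , lighter) with card<⇒∃ (bad u) F (begin
        suc (card (bad u))   ≤⟨ s≤s (few u p) ⟩
        2 + e u              ≤⟨ +-monoʳ-≤ 2 (≤-trans (m≤n+m (e u) _) (≤-trans (≤-reflexive (weight-remove P u p)) light)) ⟩
        2 + k                ≤⟨ n≤1+n _ ⟩
        3 + k                ≡⟨ sym sizeF ⟩
        card F               ∎)
      where open ≤-Reasoning
    ... | j , Fj , ok = assign-step P F u j p Pq Pq′ Fj ok
      (assign k _ _ (cong (_∧ not (q == u)) Pq) (cong (_∧ not (q′ == u)) Pq′)
        (suc-injective (trans (card-remove P u p) sizeP)) (suc-injective (trans (card-remove F j Fj) sizeF))
        (λ w p → few w (proj₁ (∧-elim p))) lighter)

-- Cliques of size N and their outside neighbours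

module CliqueOfSizeN (m N : ℕ) (3≤N : 3 ≤ N) where
  0<N : 0 < N
  0<N = ≤-trans (s≤s z≤n) 3≤N
  2≤N : 2 ≤ N
  2≤N = ≤-trans (s≤s (s≤s z≤n)) 3≤N
  open Critical m N
  open Crit
  open Counting m N 0<N

  outside : Rel → VSet → Rel
  outside A Q u w = not (Q w) ∧ A u w

  IsClique-flip : ∀ {A Q} → IsClique A Q → IsClique (flip A) Q
  IsClique-flip clique u v p q e = clique v u q p (e ∘ sym)

  clique-degree : ∀ {A} → Crit A → ∀ Q → card Q ≡ N → IsClique A Q → ∀ u → Q u ≡ true → N ≤ deg A u
  clique-degree C Q size clique u Qu with ∃-other Q u (≤-trans 2≤N (≤-reflexive (sym size)))
  ... | w , Qw , w≢u = min-degree C u w (inj₁ (clique u w Qu Qw (w≢u ∘ sym)))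

  -- N - 1 out-neighbours of u lie in Q, so a low vertex has exactly one outside. The additive form
  -- avoids a subtraction.
  outside-degree : ∀ {A} → Crit A → ∀ Q → card Q ≡ N → IsClique A Q → ∀ u → Q u ≡ true →
    card (outside A Q u) + N ≡ suc (deg A u)
  outside-degree {A} C Q size clique u Qu = begin
      card (outside A Q u) + N                          ≡⟨ cong (card (outside A Q u) +_) (sym size) ⟩
      card (outside A Q u) + card Q                     ≡⟨ sym (∑-distrib-+ {m} _ _) ⟩
      sum (λ w → [ outside A Q u w ] + [ Q w ])         ≡⟨ sum-cong-≗ pointwise ⟩
      sum (λ w → [ w == u ] + [ A u w ])                ≡⟨ ∑-distrib-+ {m} _ _ ⟩
      card (_== u) + deg A u                            ≡⟨ cong (_+ deg A u) (sum-point₁ u) ⟩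
      suc (deg A u)                                     ∎
    where
    open ≡-Reasoning
    pointwise : ∀ w → [ outside A Q u w ] + [ Q w ] ≡ [ w == u ] + [ A u w ]
    pointwise w with w ≟ u
    ... | yes refl rewrite Qu | irr C w = refl
    ... | no w≢u with bool-split (Q w)
    ...   | inj₁ q rewrite q | clique u w Qu q (w≢u ∘ sym) = refl
    ...   | inj₂ q rewrite q = +-identityʳ _

  module _ {A : Rel} (C : Crit A) (Q : VSet) (size : card Q ≡ N) (clique : IsClique A Q)
           (small : excess A + 2 < N) where

    -- A colour is forbidden at q only if outside vertices carry it in both directions, so having z
    -- as sole neighbour in one direction leaves at most the colour of z forbidden.
    Port : Fin m → Fin m → Set
    Port q z = (∀ w → Q w ≡ false → A q w ≡ true → w ≡ z) ⊎ (∀ w → Q w ≡ false → A w q ≡ true → w ≡ z)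

    module _ (c : Fin m → Fin N) (r : Fin m → ℕ)
             (h : ∀ u w → restrict A (not ∘ Q) u w ≡ true → c u ≡ c w → r u < r w) where

      enters leaves bad : Fin m → Fin N → Bool
      leaves u = image c (outside A Q u)
      enters u = image c (outside (flip A) Q u)
      bad u j = leaves u j ∧ enters u j

      image-intro : ∀ P {j} w → P w ≡ true → c w ≡ j → image c P j ≡ true
      image-intro P {j} w p t = dec-true (hit? c P j) (w , p , t)

      outside-elim : ∀ D {u w} → outside D Q u w ≡ true → Q w ≡ false × D u w ≡ true
      outside-elim D t = not-elim (proj₁ (∧-elim t)) , proj₂ (∧-elim t)

      bad-at-port : ∀ {q z} → Port q z → ∀ j → bad q j ≡ true → j ≡ c z
      bad-at-port {q} (inj₁ only) j t with does-elim (hit? c (outside A Q q) j) (proj₁ (∧-elim {leaves q j} t))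
      ... | w , p , refl = cong c (only w (proj₁ (outside-elim A p)) (proj₂ (outside-elim A p)))
      bad-at-port {q} (inj₂ only) j t with does-elim (hit? c (outside (flip A) Q q) j) (proj₂ (∧-elim {leaves q j} t))
      ... | w , p , refl = cong c (only w (proj₁ (outside-elim (flip A) p)) (proj₂ (outside-elim (flip A) p)))

      -- A vertex of Q entered from its own colour has no out-neighbour of that colour and can be
      -- put on top; any other one goes to the bottom.
      rainbow : (π : Fin m → Fin N) → (∀ u w → Q u ≡ true → Q w ≡ true → π u ≡ π w → u ≡ w) →
        (∀ u → Q u ≡ true → bad u (π u) ≡ false) → Col A
      rainbow π π-inj good = c′ , r′ , ok
        where
        top : ℕ
        top = suc (suc (sum r))
        rank : Fin m → ℕ
        rank u = if enters u (π u) then top else 0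
        c′ : Fin m → Fin N
        c′ u = if Q u then π u else c u
        r′ : Fin m → ℕ
        r′ u = if Q u then rank u else suc (r u)
        ok : ∀ u w → A u w ≡ true → c′ u ≡ c′ w → r′ u < r′ w
        ok u w a t with bool-split (Q u) | bool-split (Q w)
        ... | inj₁ p | inj₁ q = contradiction (π-inj u w p q (trans (sym (if-true p)) (trans t (if-true q)))) (arc⇒≢ C a)
        ... | inj₁ p | inj₂ q = subst₂ _<_ (sym (trans (if-true p) (if-false no-enters))) (sym (if-false q)) (s≤s z≤n)
          where
          is-leaves : leaves u (π u) ≡ true
          is-leaves = image-intro (outside A Q u) w (∧-intro (not-intro q) a)
            (sym (trans (sym (if-true p)) (trans t (if-false q))))
          no-enters : enters u (π u) ≡ false
          no-enters = false-intro λ i → true≢false (∧-intro is-leaves i) (good u p)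
        ... | inj₂ p | inj₁ q = subst₂ _<_ (sym (if-false p)) (sym (trans (if-true q) (if-true is-enters)))
            (s≤s (s≤s (term≤sum r u)))
          where
          is-enters : enters w (π w) ≡ true
          is-enters = image-intro (outside (flip A) Q w) u (∧-intro (not-intro p) a)
            (trans (sym (if-false p)) (trans t (if-true q)))
        ... | inj₂ p | inj₂ q = subst₂ _<_ (sym (if-false p)) (sym (if-false q))
          (s≤s (h u w (restrict-intro A (not ∘ Q) a (not-intro p) (not-intro q))
            (trans (sym (if-false p)) (trans t (if-false q)))))

      -- A vertex u of Q has at most one forbidden colour more than its surplus `deg A u ∸ N`, and
      -- the surpluses sum to less than N - 2, so `assign` applies. The ports q and q′ forbid only
      -- the distinct colours of z and z′.
      port-colours : ∀ {q q′ z z′} → Q q ≡ true → Q q′ ≡ true → q ≢ q′ → Port q z → Port q′ z′ → c z ≢ c z′ → Col A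
      port-colours {q} {q′} {z} {z′} Qq Qq′ q≢q′ port port′ cz≢cz′ =
          rainbow π (λ u w p p′ → injective u w (domain u p) (domain w p′)) good′
        where
        open Greedy m N bad (λ u → deg A u ∸ N) q q′ q≢q′ (c z) (c z′) cz≢cz′
        k = N ∸ 2
        N≡2+k : N ≡ 2 + k
        N≡2+k = sym (m+[n∸m]≡n 2≤N)
        P₁ P : VSet
        P₁ u = Q u ∧ not (u == q)
        P u = P₁ u ∧ not (u == q′)
        P₁q′ : P₁ q′ ≡ true
        P₁q′ = ∧-intro Qq′ (not-intro (≢⇒== (q≢q′ ∘ sym)))
        sizeP : card P ≡ k
        sizeP = suc-injective (suc-injective (trans (cong suc (card-remove P₁ q′ P₁q′))
          (trans (card-remove Q q Qq) (trans size N≡2+k))))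
        few : ∀ u → P u ≡ true → card (bad u) ≤ suc (deg A u ∸ N)
        few u p = +-cancelʳ-≤ N _ _ (begin
            card (bad u) + N                ≤⟨ +-monoˡ-≤ N (card-mono λ j t → proj₁ (∧-elim {leaves u j} t)) ⟩
            card (leaves u) + N               ≤⟨ +-monoˡ-≤ N (card-image c (outside A Q u)) ⟩
            card (outside A Q u) + N        ≡⟨ outside-degree C Q size clique u (proj₁ (∧-elim (proj₁ (∧-elim p)))) ⟩
            suc (deg A u)                   ≤⟨ s≤s (m≤n+m∸n (deg A u) N) ⟩
            suc (N + (deg A u ∸ N))         ≡⟨ cong suc (+-comm N _) ⟩
            suc (deg A u ∸ N) + N           ∎)
          where open ≤-Reasoning
        -- By `small` the excess is at most N - 3, and k is N - 2.
        light : weight P ≤ k ∸ 1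
        light = ≤-trans (sum-mono λ u → ≤-trans (*-monoˡ-≤ (deg A u ∸ N) ([]≤1 (P u))) (≤-reflexive (*-identityˡ _)))
          (<⇒≤pred (≤-pred (≤-pred (≤-trans (≤-reflexive (cong suc (+-comm 2 (excess A)))) (≤-trans small (≤-reflexive N≡2+k))))))
        open Assignment (assign k P (λ _ → true)
          (trans (cong (λ t → (Q q ∧ not t) ∧ not (q == q′)) (==-refl q)) (cong (_∧ not (q == q′)) (Bool.∧-zeroʳ (Q q))))
          (trans (cong (λ t → P₁ q′ ∧ not t) (==-refl q′)) (Bool.∧-zeroʳ (P₁ q′)))
          sizeP (trans (sum-const-1 N) N≡2+k) few light)
        domain : ∀ u → Q u ≡ true → Domain P u
        domain u p with bool-split (u == q) | bool-split (u == q′)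
        ... | inj₁ s | _ = inj₂ (inj₁ (==⇒≡ u q s))
        ... | inj₂ s | inj₁ t = inj₂ (inj₂ (==⇒≡ u q′ t))
        ... | inj₂ s | inj₂ t = inj₁ (∧-intro (∧-intro p (not-intro s)) (not-intro t))
        good′ : ∀ u → Q u ≡ true → bad u (π u) ≡ false
        good′ u p with domain u p
        ... | inj₁ d = good u d
        ... | inj₂ (inj₁ refl) = false-intro λ t → πq≢a (bad-at-port port (π q) t)
        ... | inj₂ (inj₂ refl) = false-intro λ t → πq′≢b (bad-at-port port′ (π q′) t)

    -- Otherwise add the digon zz′ to A - Q. Ranks cannot increase along both of its arcs, so every
    -- colouring separates z from z′ and `port-colours` would extend it to A. A critical subdigraph
    -- has its live vertices outside Q; it loses no vertex and has two new arcs, so `excess-compare`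
    -- with t = 0 and s = 2 contradicts `small`.
    ports-agree : ∀ {q q′ z z′} → Q q ≡ true → Q q′ ≡ true → q ≢ q′ → Port q z → Port q′ z′ →
      Q z ≡ false → Q z′ ≡ false → live A z ≡ true → live A z′ ≡ true → z ≡ z′
    ports-agree {q} {q′} {z} {z′} Qq Qq′ q≢q′ port port′ z∉ z′∉ z-live z′-live with z ≟ z′
    ... | yes e = e
    ... | no z≢z′ = ⊥-elim (critical-subdigraph (arcs D) D ≤-refl D-irr ¬colD
          λ { (B , B⊆D , CB) → <⇒≱ small (begin
            N                             ≤⟨ m≤n+m N (excess B) ⟩
            excess B + N                  ≤⟨ excess-compare CB (live B) 0 2 (count CB B⊆D) (leave CB B⊆D) (m≤m+n _ 0) ⟩
            excess A + N * 0 + 2          ≡⟨ cong (λ t → excess A + t + 2) (*-zeroʳ N) ⟩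
            excess A + 0 + 2              ≡⟨ cong (_+ 2) (+-identityʳ (excess A)) ⟩
            excess A + 2                  ∎) })
      where
      open ≤-Reasoning
      D : Rel
      D u w = restrict A (not ∘ Q) u w ∨ (((u == z) ∧ (w == z′)) ∨ ((u == z′) ∧ (w == z)))
      D-elim : ∀ u w → D u w ≡ true → restrict A (not ∘ Q) u w ≡ true ⊎ (u ≡ z × w ≡ z′) ⊎ (u ≡ z′ × w ≡ z)
      D-elim u w d with ∨-elim {restrict A (not ∘ Q) u w} d
      ... | inj₁ a = inj₁ a
      ... | inj₂ d with ∨-elim {(u == z) ∧ (w == z′)} d
      ...   | inj₁ a = inj₂ (inj₁ (==⇒≡ u z (proj₁ (∧-elim a)) , ==⇒≡ w z′ (proj₂ (∧-elim {u == z} a))))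
      ...   | inj₂ a = inj₂ (inj₂ (==⇒≡ u z′ (proj₁ (∧-elim a)) , ==⇒≡ w z (proj₂ (∧-elim {u == z′} a))))
      zz′ : D z z′ ≡ true
      zz′ = ∨-introʳ {restrict A (not ∘ Q) z z′} (∨-introˡ (∧-intro (==-refl z) (==-refl z′)))
      z′z : D z′ z ≡ true
      z′z = ∨-introʳ {restrict A (not ∘ Q) z′ z} (∨-introʳ {(z′ == z) ∧ (z == z′)} (∧-intro (==-refl z′) (==-refl z)))
      D-irr : Irreflexive D
      D-irr u = false-intro λ d → loop (D-elim u u d)
        where
        loop : restrict A (not ∘ Q) u u ≡ true ⊎ (u ≡ z × u ≡ z′) ⊎ (u ≡ z′ × u ≡ z) → ⊥
        loop (inj₁ a) = arc⇒≢ C (restrict⊆ A (not ∘ Q) u u a) refl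
        loop (inj₂ (inj₁ (e , e′))) = z≢z′ (trans (sym e) e′)
        loop (inj₂ (inj₂ (e , e′))) = z≢z′ (trans (sym e′) e)
      ¬colD : ¬ Col D
      ¬colD (c , r , h) = ¬col C (port-colours c r (λ u w a → h u w (∨-introˡ a)) Qq Qq′ q≢q′ port port′
        λ e → <-asym (h z z′ zz′ e) (h z′ z z′z (sym e)))
      module _ {B : Rel} (CB : Crit B) (B⊆D : B ⊆ D) where
        live-outside : ∀ u → live B u ≡ true → Q u ≡ false × live A u ≡ true
        live-outside u l with live⇒arc B u l
        ... | w , b with D-elim u w (B⊆D u w b)
        ...   | inj₁ a = not-elim (proj₁ (∧-elim {not (Q u)} (proj₂ (∧-elim {A u w} a)))) , arc⇒live C (restrict⊆ A (not ∘ Q) u w a)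
        ...   | inj₂ (inj₁ (refl , _)) = z∉ , z-live
        ...   | inj₂ (inj₂ (refl , _)) = z′∉ , z′-live
        q-dead : live B q ≡ false
        q-dead = false-intro λ l → true≢false Qq (proj₁ (live-outside q l))
        leave : N ≤ cutSize A (live B)
        leave with some-arc (¬col CB)
        ... | u , w , b with live⇒arc A u (proj₂ (live-outside u (arc⇒live CB b)))
        ...   | _ , a = cut C (live B) a (arc⇒live CB b) (clique q q′ Qq Qq′ q≢q′) q-dead
        leaving : Fin m → Fin m → Bool
        leaving u w = live B u ∧ (not (live B w) ∧ A u w)
        -- Arcs of B end at live vertices and leaving arcs do not, so both fit among the arcs of A,
        -- up to one new arc from z and one from z′.
        row : ∀ u → deg B u + card (leaving u) ≤ [ live B u ] * deg A u + ([ u == z ] * 1 + [ u == z′ ] * 1)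
        row u with bool-split (live B u)
        ... | inj₂ l = ≤-trans (≤-reflexive (cong₂ _+_ (¬live⇒deg≡0 B u l)
            (sum-zero (λ w → [ leaving u w ]) λ w → [false] (cong (_∧ (not (live B w) ∧ A u w)) l)))) z≤n
        ... | inj₁ l = begin
            deg B u + card (leaving u)                                                               ≡⟨ sym (∑-distrib-+ {m} _ _) ⟩
            sum (λ w → [ B u w ] + [ leaving u w ])                                                  ≤⟨ sum-mono pointwise ⟩
            sum (λ w → [ A u w ] + ([ w == z′ ] * ([ u == z ] * 1) + [ w == z ] * ([ u == z′ ] * 1))) ≡⟨ ∑-distrib-+ {m} _ _ ⟩
            deg A u + sum (λ w → [ w == z′ ] * ([ u == z ] * 1) + [ w == z ] * ([ u == z′ ] * 1))     ≡⟨ cong (deg A u +_) (trans (∑-distrib-+ {m} _ _) (cong₂ _+_ (sum-point z′ _) (sum-point z _))) ⟩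
            deg A u + ([ u == z ] * 1 + [ u == z′ ] * 1)                                             ≡⟨ cong (_+ ([ u == z ] * 1 + [ u == z′ ] * 1)) (sym (trans (cong (_* deg A u) ([true] l)) (*-identityˡ _))) ⟩
            [ live B u ] * deg A u + ([ u == z ] * 1 + [ u == z′ ] * 1)                              ∎
          where
          bound : Fin m → ℕ
          bound w = [ A u w ] + ([ w == z′ ] * ([ u == z ] * 1) + [ w == z ] * ([ u == z′ ] * 1))
          from-A : ∀ w → A u w ≡ true → 1 ≤ bound w
          from-A w a = ≤-trans ([]≥1 a) (m≤m+n _ _)
          unit : ∀ {u v w z : Fin m} → u ≡ v → w ≡ z → 1 ≤ [ w == z ] * ([ u == v ] * 1)
          unit {u} {_} {w} refl refl = ≤-reflexive (sym (cong₂ (λ s t → s * (t * 1)) ([true] (==-refl w)) ([true] (==-refl u))))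
          from-B : ∀ w → B u w ≡ true → 1 ≤ bound w
          from-B w b with D-elim u w (B⊆D u w b)
          ... | inj₁ a = from-A w (restrict⊆ A (not ∘ Q) u w a)
          ... | inj₂ (inj₁ (e , e′)) = ≤-trans (unit e e′) (≤-trans (m≤m+n _ _) (m≤n+m _ [ A u w ]))
          ... | inj₂ (inj₂ (e , e′)) = ≤-trans (unit e e′) (≤-trans (m≤n+m _ ([ w == z′ ] * ([ u == z ] * 1))) (m≤n+m _ [ A u w ]))
          pointwise : ∀ w → [ B u w ] + [ leaving u w ] ≤ bound w
          pointwise w = []+[]≤ (B u w) (leaving u w) (from-B w)
            (λ t → from-A w (proj₂ (∧-elim {not (live B w)} (proj₂ (∧-elim {live B u} t)))))
            (λ b t → ⊥-elim (true≢false (arc⇒live′ CB b) (not-elim (proj₁ (∧-elim {not (live B w)} (proj₂ (∧-elim {live B u} t)))))))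
        count : arcs B + cutSize A (live B) ≤ arcsFrom A (live B) + 2
        count = begin
          arcs B + cutSize A (live B)                                                            ≡⟨ sym (∑-distrib-+ {m} (deg B) _) ⟩
          sum (λ u → deg B u + card (leaving u))                                                 ≤⟨ sum-mono row ⟩
          sum (λ u → [ live B u ] * deg A u + ([ u == z ] * 1 + [ u == z′ ] * 1))                ≡⟨ ∑-distrib-+ {m} _ _ ⟩
          arcsFrom A (live B) + sum (λ u → [ u == z ] * 1 + [ u == z′ ] * 1)                     ≡⟨ cong (arcsFrom A (live B) +_) (trans (∑-distrib-+ {m} _ _) (cong₂ _+_ (sum-point z 1) (sum-point z′ 1))) ⟩
          arcsFrom A (live B) + 2                                                                ∎

    unique-exit : ∀ o → Q o ≡ true → low A o ≡ true →
      ∃ λ z → Q z ≡ false × A o z ≡ true × (∀ w → Q w ≡ false → A o w ≡ true → w ≡ z)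
    unique-exit o Qo l = exit (card-positive⇒∃ (outside A Q o) (≤-reflexive (sym single)))
      where
      single : card (outside A Q o) ≡ 1
      single = +-cancelʳ-≡ N _ 1 (trans (outside-degree C Q size clique o Qo) (cong suc (low⇒deg A o l)))
      exit : (∃ λ z → outside A Q o z ≡ true) →
        ∃ λ z → Q z ≡ false × A o z ≡ true × (∀ w → Q w ≡ false → A o w ≡ true → w ≡ z)
      exit (z , p) = z , not-elim (proj₁ (∧-elim p)) , proj₂ (∧-elim {not (Q z)} p) , only
        where
        only : ∀ w → Q w ≡ false → A o w ≡ true → w ≡ z
        only w w∉ a with w ≟ z
        ... | yes e = e
        ... | no w≢z = ⊥-elim (1+n≰n (begin
            2                              ≡⟨ cong suc (sym (sum-point₁ w)) ⟩
            suc (card (_== w))             ≤⟨ card-insert (_== w) (outside A Q o) z (≢⇒== (w≢z ∘ sym)) p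
                                                (λ u t → subst (λ v → outside A Q o v ≡ true) (sym (==⇒≡ u w t)) (∧-intro (not-intro w∉) a)) ⟩
            card (outside A Q o)           ≡⟨ single ⟩
            1                              ∎))
          where open ≤-Reasoning

-- The lower bound on the excess

module ExcessBound (m N : ℕ) (3≤N : 3 ≤ N) where
  open CliqueOfSizeN m N 3≤N
  open Critical m N
  open Crit
  open Counting m N 0<N
  open Merging m N 0<N
  open Fork

  record Hub (A : Rel) (Q : VSet) : Set where
    field
      z    : Fin m
      z∉   : Q z ≡ false
      from : ∀ o → Q o ≡ true → low A o ≡ true → A o z ≡ true
      to   : ∀ i → Q i ≡ true → low (flip A) i ≡ true → A z i ≡ true

  module _ {A : Rel} (C : Crit A) (Q : VSet) (size : card Q ≡ N) (clique : IsClique A Q)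
           (small : excess A + 2 < N) where

    small⁻ : excess (flip A) + 2 < N
    small⁻ = subst (λ t → t + 2 < N) (sym (excess-flip C)) small

    clique⁻ : IsClique (flip A) Q
    clique⁻ = IsClique-flip {A} {Q} clique

    -- The hub is the exit of one low vertex a, and `ports-agree` carries it to the others. A second
    -- low vertex b is there because only distinct vertices of Q are compared and a may have low
    -- in-degree as well.
    hub : Hub A Q
    hub with card-positive⇒∃ _ (≤-trans (s≤s z≤n) (many-low Q (≤-reflexive (sym size)) (clique-degree C Q size clique) small))
    ... | a , a-low with ∃-other _ a (≤-trans (s≤s (s≤s z≤n)) (many-low Q (≤-reflexive (sym size)) (clique-degree C Q size clique) small))
    ... | b , b-low , b≢a with unique-exit C Q size clique small a (proj₁ (∧-elim a-low)) (proj₂ (∧-elim {Q a} a-low))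
                             | unique-exit C Q size clique small b (proj₁ (∧-elim b-low)) (proj₂ (∧-elim {Q b} b-low))
    ... | z , z∉ , a→z , only-a | z′ , z′∉ , b→z′ , only-b = record { z = z ; z∉ = z∉ ; from = from′ ; to = to′ }
      where
      Qa = proj₁ (∧-elim {Q a} a-low)
      Qb = proj₁ (∧-elim {Q b} b-low)
      agree : ∀ {q q′ w w′} → Q q ≡ true → Q q′ ≡ true → q ≢ q′ → Port C Q size clique small q w →
        Port C Q size clique small q′ w′ → Q w ≡ false → Q w′ ≡ false → live A w ≡ true → live A w′ ≡ true → w ≡ w′
      agree = ports-agree C Q size clique small
      z≡z′ : z ≡ z′
      z≡z′ = agree Qa Qb (b≢a ∘ sym) (inj₁ only-a) (inj₁ only-b) z∉ z′∉ (arc⇒live′ C a→z) (arc⇒live′ C b→z′)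
      from′ : ∀ o → Q o ≡ true → low A o ≡ true → A o z ≡ true
      from′ o Qo l with o ≟ a
      ... | yes refl = a→z
      ... | no o≢a with unique-exit C Q size clique small o Qo l
      ...   | w , w∉ , o→w , only-o = subst (λ t → A o t ≡ true)
        (agree Qo Qa o≢a (inj₁ only-o) (inj₁ only-a) w∉ z∉ (arc⇒live′ C o→w) (arc⇒live′ C a→z)) o→w
      to′ : ∀ i → Q i ≡ true → low (flip A) i ≡ true → A z i ≡ true
      to′ i Qi l with unique-exit (Crit-flip C) Q size clique⁻ small⁻ i Qi l
      ... | w , w∉ , w→i , only-i with i ≟ a
      ...   | no i≢a = subst (λ t → A t i ≡ true)
        (agree Qi Qa i≢a (inj₂ only-i) (inj₁ only-a) w∉ z∉ (arc⇒live C w→i) (arc⇒live′ C a→z)) w→i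
      ...   | yes refl = subst (λ t → A t i ≡ true)
        (trans (agree Qi Qb (b≢a ∘ sym) (inj₂ only-i) (inj₁ only-b) w∉ z′∉ (arc⇒live C w→i) (arc⇒live′ C b→z′)) (sym z≡z′)) w→i

  module _ {A : Rel} (C : Crit A) (Q : VSet) (size : card Q ≡ N) (clique : IsClique A Q)
           (lows : 3 ≤ card (λ u → Q u ∧ low A u))
           (z : Fin m) (z∉ : Q z ≡ false) (q : Fin m) (q∈ : Q q ≡ true)
           (from : ∀ o → Q o ≡ true → low A o ≡ true → A o z ≡ true)
           (I : VSet) (I⊆Q : ∀ i → I i ≡ true → Q i ≡ true) (to : ∀ i → I i ≡ true → A z i ≡ true)
           (F : Fork A q z) where

    Q′ O P : VSet
    Q′ = Fork.Q F
    O u = Q u ∧ low A u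
    P u = Q u ∧ Q′ u

    -- A low vertex of Q points to both q and z, which the fork forbids for its own low vertices.
    Q′-not-low : ∀ u → Q u ≡ true → Q′ u ≡ true → low A u ≡ false
    Q′-not-low u Qu Q′u = false-intro λ l → notLow F u Q′u (low⇒deg A u l)
      (clique u q Qu q∈ λ { refl → true≢false Q′u (x∉ F) }) (from u Qu l)

    P+O≤N : card P + card O ≤ N
    P+O≤N = begin
        card P + card O                    ≡⟨ sym (∑-distrib-+ {m} _ _) ⟩
        sum (λ u → [ P u ] + [ O u ])      ≤⟨ sum-mono (λ u → []+[]≤ (P u) (O u) (λ p → []≥1 (proj₁ (∧-elim p))) (λ p → []≥1 (proj₁ (∧-elim p)))
                                                (λ p o → ⊥-elim (true≢false (proj₂ (∧-elim {Q u} o)) (Q′-not-low u (proj₁ (∧-elim p)) (proj₂ (∧-elim {Q u} p)))))) ⟩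
        card Q                             ≡⟨ size ⟩
        N                                  ∎
      where open ≤-Reasoning

    P+3≤N : card P + 3 ≤ N
    P+3≤N = ≤-trans (+-monoʳ-≤ (card P) lows) P+O≤N

    -- The vertices z and q together send arcs to I, to Q - q and to Q′.
    hub-degrees : card I + (N + N) ≤ deg A z + deg A q + suc (card P)
    hub-degrees = begin
        card I + (N + N)                                              ≡⟨ cong (card I +_) (cong₂ _+_ (sym Q-q) (sym Q′-Q)) ⟩
        card I + (suc (card R) + (card S + card P))                   ≡⟨ rearrange (card I) (card R) (card S) (card P) ⟩
        card I + (card R + card S) + suc (card P)                     ≡⟨ cong (_+ suc (card P)) (cong (card I +_) (sym (∑-distrib-+ {m} _ _))) ⟩
        card I + sum (λ w → [ R w ] + [ S w ]) + suc (card P)         ≡⟨ cong (_+ suc (card P)) (sym (∑-distrib-+ {m} _ _)) ⟩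
        sum (λ w → [ I w ] + ([ R w ] + [ S w ])) + suc (card P)      ≤⟨ +-monoˡ-≤ (suc (card P)) (sum-mono pointwise) ⟩
        sum (λ w → [ A z w ] + [ A q w ]) + suc (card P)              ≡⟨ cong (_+ suc (card P)) (∑-distrib-+ {m} _ _) ⟩
        deg A z + deg A q + suc (card P)                              ∎
      where
      open ≤-Reasoning
      R S : VSet
      R w = Q w ∧ not (w == q)
      S w = Q′ w ∧ not (Q w)
      Q-q : suc (card R) ≡ N
      Q-q = trans (card-remove Q q q∈) size
      split : ∀ a b → [ a ∧ not b ] + [ b ∧ a ] ≡ [ a ]
      split true true = refl
      split true false = refl
      split false true = refl
      split false false = refl
      Q′-Q : card S + card P ≡ N
      Q′-Q = trans (sym (∑-distrib-+ {m} _ _)) (trans (sum-cong-≗ (λ w → split (Q′ w) (Q w))) (Fork.size F))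
      rearrange : ∀ i r s p → i + (suc r + (s + p)) ≡ i + (r + s) + suc p
      rearrange i r s p = trans (cong (i +_) (trans (cong suc (sym (+-assoc r s p))) (sym (+-suc (r + s) p))))
        (sym (+-assoc i (r + s) (suc p)))
      -- Inside Q, z reaches I and q reaches the rest of Q; outside Q, each vertex of Q′ is reached
      -- from q or from z by the fork.
      pointwise : ∀ w → [ I w ] + ([ R w ] + [ S w ]) ≤ [ A z w ] + [ A q w ]
      pointwise w with bool-split (Q w)
      ... | inj₁ Qw = +-mono-≤ ([]-mono (to w)) (≤-trans (≤-reflexive (trans (cong ([ R w ] +_)
          ([false] (false-intro λ t → true≢false Qw (not-elim (proj₂ (∧-elim {Q′ w} t)))))) (+-identityʳ _)))
        ([]-mono λ t → clique q w q∈ Qw (==⇒≢ w q (not-elim (proj₂ (∧-elim {Q w} t))) ∘ sym)))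
      ... | inj₂ Qw = ≤-trans (≤-reflexive (cong₂ _+_ ([false] (false-intro λ t → true≢false (I⊆Q w t) Qw))
          (cong (_+ [ S w ]) ([false] (false-intro λ t → true≢false (proj₁ (∧-elim t)) Qw)))))
        ([]≤ (S w) λ t → reached (into F w (proj₁ (∧-elim t))))
        where
        reached : A q w ≡ true ⊎ A z w ≡ true → 1 ≤ [ A z w ] + [ A q w ]
        reached (inj₁ a) = ≤-trans ([]≥1 a) (m≤n+m _ _)
        reached (inj₂ a) = ≤-trans ([]≥1 a) (m≤m+n _ _)

    -- A vertex common to both cliques is joined to all other vertices of their union, at least 2N -
    -- (N - 3) - 1 = N + 2 of them.
    shared-degree : ∀ u → P u ≡ true → 2 ≤ deg A u ∸ N
    shared-degree u p = ≤-trans (≤-reflexive (sym (m+n∸m≡n N 2))) (∸-monoˡ-≤ N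
        (+-cancelʳ-≤ (N + suc (card P)) (N + 2) (deg A u) (begin
          N + 2 + (N + suc (card P))                    ≡⟨ +-assoc N 2 _ ⟩
          N + (2 + (N + suc (card P)))                  ≡⟨ cong (N +_) (cong (2 +_) (+-comm N (suc (card P)))) ⟩
          N + (3 + card P + N)                          ≡⟨ cong (λ t → N + (t + N)) (+-comm 3 (card P)) ⟩
          N + (card P + 3 + N)                          ≤⟨ +-monoʳ-≤ N (+-monoˡ-≤ N P+3≤N) ⟩
          N + (N + N)                                   ≤⟨ +-monoʳ-≤ N union ⟩
          N + (deg A u + suc (card P))                  ≡⟨ sym (+-assoc N (deg A u) _) ⟩
          N + deg A u + suc (card P)                    ≡⟨ cong (_+ suc (card P)) (+-comm N (deg A u)) ⟩
          deg A u + N + suc (card P)                    ≡⟨ +-assoc (deg A u) N _ ⟩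
          deg A u + (N + suc (card P))                  ∎)))
      where
      open ≤-Reasoning
      Qu = proj₁ (∧-elim {Q u} p)
      Q′u = proj₂ (∧-elim {Q u} p)
      union : N + N ≤ deg A u + suc (card P)
      union = begin
          N + N                                                    ≡⟨ cong₂ _+_ (sym size) (sym (Fork.size F)) ⟩
          card Q + card Q′                                         ≡⟨ sym (∑-distrib-+ {m} _ _) ⟩
          sum (λ w → [ Q w ] + [ Q′ w ])                           ≤⟨ sum-mono pointwise ⟩
          sum (λ w → [ A u w ] + ([ w == u ] + [ P w ]))           ≡⟨ ∑-distrib-+ {m} _ _ ⟩
          deg A u + sum (λ w → [ w == u ] + [ P w ])               ≡⟨ cong (deg A u +_) (∑-distrib-+ {m} _ _) ⟩
          deg A u + (card (_== u) + card P)                        ≡⟨ cong (λ t → deg A u + (t + card P)) (sum-point₁ u) ⟩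
          deg A u + suc (card P)                                   ∎
        where
        pointwise : ∀ w → [ Q w ] + [ Q′ w ] ≤ [ A u w ] + ([ w == u ] + [ P w ])
        pointwise w with w ≟ u
        ... | yes refl rewrite Qu | Q′u = m≤n+m 2 _
        ... | no w≢u = []+[]≤ (Q w) (Q′ w)
            (λ a → ≤-trans ([]≥1 (clique u w Qu a (w≢u ∘ sym))) (m≤m+n _ _))
            (λ b → ≤-trans ([]≥1 (clique′ b)) (m≤m+n _ _))
            (λ a b → +-mono-≤ ([]≥1 (clique′ b)) ([]≥1 (∧-intro a b)))
          where
          clique′ : Q′ w ≡ true → A u w ≡ true
          clique′ b = Fork.clique F u w Q′u b (w≢u ∘ sym)

    -- The surpluses of z and q are bounded below by `hub-degrees`. Every other vertex of Q that is
    -- not low adds one, and those in P add a second one, which cancels the overlap of the cliques.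
    -- In the application I consists of the vertices of Q of low in-degree, so that reversal
    -- exchanges the roles of I and O.
    excess-lower : N + card I ≤ excess A + card O + 2
    excess-lower = +-cancelʳ-≤ (N + N) _ _ (begin
        N + card I + (N + N)                                                    ≡⟨ +-assoc N (card I) (N + N) ⟩
        N + (card I + (N + N))                                                  ≤⟨ +-mono-≤ others hub-degrees ⟩
        card R + card O + 1 + (deg A z + deg A q + suc (card P))                ≤⟨ +-monoʳ-≤ (card R + card O + 1) (+-monoˡ-≤ (suc (card P)) (+-mono-≤ (m≤n+m∸n (deg A z) N) (m≤n+m∸n (deg A q) N))) ⟩
        card R + card O + 1 + (N + ez + (N + eq) + suc (card P))                ≡⟨ solve 6 (λ r o n a b p → r :+ o :+ con 1 :+ (n :+ a :+ (n :+ b) :+ (con 1 :+ p))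
                                                                                     := a :+ (b :+ (r :+ p)) :+ o :+ con 2 :+ (n :+ n)) refl (card R) (card O) N ez eq (card P) ⟩
        ez + (eq + (card R + card P)) + card O + 2 + (N + N)                    ≤⟨ +-monoˡ-≤ (N + N) (+-monoˡ-≤ 2 (+-monoˡ-≤ (card O) total)) ⟩
        excess A + card O + 2 + (N + N)                                         ∎)
      where
      open ≤-Reasoning
      ez = deg A z ∸ N
      eq = deg A q ∸ N
      R : VSet
      R u = Q u ∧ (not (u == q) ∧ not (low A u))
      others : N ≤ card R + card O + 1
      others = begin
          N                                                  ≡⟨ sym size ⟩
          card Q                                             ≤⟨ sum-mono pointwise ⟩
          sum (λ u → [ R u ] + [ O u ] + [ u == q ])         ≡⟨ ∑-distrib-+ {m} _ _ ⟩
          sum (λ u → [ R u ] + [ O u ]) + card (_== q)       ≡⟨ cong₂ _+_ (∑-distrib-+ {m} _ _) (sum-point₁ q) ⟩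
          card R + card O + 1                                ∎
        where
        cases : ∀ a b c → [ a ] ≤ [ a ∧ (not b ∧ not c) ] + [ a ∧ c ] + [ b ]
        cases false b c = z≤n
        cases true true c = m≤n+m 1 _
        cases true false true = ≤-refl
        cases true false false = ≤-refl
        pointwise : ∀ u → [ Q u ] ≤ [ R u ] + [ O u ] + [ u == q ]
        pointwise u = cases (Q u) (u == q) (low A u)
      total : ez + (eq + (card R + card P)) ≤ excess A
      total = begin
          ez + (eq + (card R + card P))                                                              ≡⟨ cong₂ (λ s t → s + (t + (card R + card P))) (sym (sum-point z ez)) (sym (sum-point q eq)) ⟩
          sum (λ u → [ u == z ] * ez) + (sum (λ u → [ u == q ] * eq) + (card R + card P))            ≡⟨ cong (λ t → sum (λ u → [ u == z ] * ez) + (sum (λ u → [ u == q ] * eq) + t)) (sym (∑-distrib-+ {m} _ _)) ⟩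
          sum (λ u → [ u == z ] * ez) + (sum (λ u → [ u == q ] * eq) + sum (λ u → [ R u ] + [ P u ])) ≡⟨ cong (sum (λ u → [ u == z ] * ez) +_) (sym (∑-distrib-+ {m} _ _)) ⟩
          sum (λ u → [ u == z ] * ez) + sum (λ u → [ u == q ] * eq + ([ R u ] + [ P u ]))            ≡⟨ sym (∑-distrib-+ {m} _ _) ⟩
          sum (λ u → [ u == z ] * ez + ([ u == q ] * eq + ([ R u ] + [ P u ])))                      ≤⟨ sum-mono pointwise ⟩
          excess A                                                                                   ∎
        where
        P∌q : P q ≡ false
        P∌q = trans (cong (Q q ∧_) (x∉ F)) (Bool.∧-zeroʳ (Q q))
        rest : ∀ u → [ R u ] + [ P u ] ≤ deg A u ∸ N
        rest u = []+[]≤ (R u) (P u)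
          (λ t → m<n⇒0<n∸m (≤∧≢⇒< (clique-degree C Q size clique u (proj₁ (∧-elim t)))
            (does-elim-false (deg A u ℕ.≟ N) (not-elim (proj₂ (∧-elim {not (u == q)} (proj₂ (∧-elim {Q u} t))))) ∘ sym)))
          (λ t → ≤-trans (s≤s z≤n) (shared-degree u t))
          (λ _ t → shared-degree u t)
        pointwise : ∀ u → [ u == z ] * ez + ([ u == q ] * eq + ([ R u ] + [ P u ])) ≤ deg A u ∸ N
        pointwise u with u ≟ z | u ≟ q
        ... | yes refl | yes refl = ⊥-elim (true≢false q∈ z∉)
        ... | yes refl | no _ rewrite z∉ = ≤-reflexive (trans (+-identityʳ _) (+-identityʳ _))
        ... | no _ | yes refl rewrite P∌q = ≤-reflexive (trans (cong (eq + 0 +_) (trans (+-identityʳ _) ([false] (Bool.∧-zeroʳ (Q q)))))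
            (trans (+-identityʳ _) (+-identityʳ _)))
        ... | no _ | no u≢q = subst (λ b → [ Q u ∧ (not b ∧ not (low A u)) ] + [ P u ] ≤ deg A u ∸ N) (≢⇒== u≢q) (rest u)

  Smaller : Rel → Set
  Smaller A = ∀ B → card (live B) < card (live A) → Crit B → Free B → N ≤ excess B + 2

  module _ {A : Rel} (C : Crit A) (free : Free A) (ih : Smaller A) (small : excess A + 2 < N) where

    -- One of the two arcs between x and y is missing; `merge` expects it to be the one from y to x,
    -- and `Fork-swap` covers the other case.
    fork-or-digon : ∀ v x y → x ≢ y → deg A v ≡ N → A v x ≡ true → A v y ≡ true → A x y ∧ A y x ≡ false →
      ¬ ¬ Fork A x y
    fork-or-digon v x y x≢y v-low v→x v→y apart k with bool-split (A y x)
    ... | inj₂ y↛x = merge C free x y v x≢y y↛x v→x v→y v-low ih small k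
    ... | inj₁ y→x = merge C free y x v (x≢y ∘ sym) x↛y v→y v→x v-low ih small (k ∘ Fork-swap)
      where
      x↛y : A x y ≡ false
      x↛y = trans (sym (Bool.∧-identityʳ (A x y))) (trans (cong (A x y ∧_) (sym y→x)) apart)

    -- If every low vertex v had a complete out-neighbourhood T, then a vertex w outside T
    -- reached from a low vertex of T would extend T to a clique of size N + 1.
    no-fork⇒⊥ : (∀ x y → Fork A x y → ⊥) → ⊥
    no-fork⇒⊥ no-fork = from-vertex some-low
      where
      dense : ∀ v x y → deg A v ≡ N → A v x ≡ true → A v y ≡ true → x ≢ y → A x y ≡ true
      dense v x y v-low v→x v→y x≢y with bool-split (A x y ∧ A y x)
      ... | inj₁ both = proj₁ (∧-elim both)
      ... | inj₂ apart = ⊥-elim (fork-or-digon v x y x≢y v-low v→x v→y apart (no-fork x y))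
      lowNeighbours : Fin m → VSet
      lowNeighbours u w = A u w ∧ low A w
      many : ∀ u → N ≤ deg A u → 3 ≤ card (lowNeighbours u)
      many u h = many-low (A u) h (λ w a → min-degree C w u (inj₂ a)) small
      some-low : ∃ λ v → deg A v ≡ N
      some-low with some-arc (¬col C)
      ... | u , w , a with card-positive⇒∃ _ (≤-trans (s≤s z≤n) (many u (min-degree C u w (inj₁ a))))
      ...   | v , t = v , low⇒deg A v (proj₂ (∧-elim {A u v} t))
      from-vertex : (∃ λ v → deg A v ≡ N) → ⊥
      from-vertex (v , v-low) with card-positive⇒∃ _ (≤-trans (s≤s z≤n) (many v (≤-reflexive (sym v-low))))
      ... | a , a∈ with ∃-other _ a (≤-trans (s≤s (s≤s z≤n)) (many v (≤-reflexive (sym v-low))))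
      ... | b , b∈ , b≢a = free ((λ u → (u == w) ∨ T u) , trans (card-adjoin T w w∉T) (cong suc v-low) , enlarged)
        where
        T : VSet
        T = A v
        Ta = proj₁ (∧-elim {T a} a∈)
        Tb = proj₁ (∧-elim {T b} b∈)
        a-low = low⇒deg A a (proj₂ (∧-elim {T a} a∈))
        b-low = low⇒deg A b (proj₂ (∧-elim {T b} b∈))
        T-a : VSet
        T-a u = T u ∧ not (u == a)
        -- The low vertex a has N out-neighbours, but T without a has only N - 1 elements.
        new : ∃ λ w → A a w ≡ true × T-a w ≡ false
        new = card<⇒∃ T-a (A a) (≤-reflexive (trans (card-remove T a Ta) (trans v-low (sym a-low))))
        w = proj₁ new
        a→w : A a w ≡ true
        a→w = proj₁ (proj₂ new)
        w∉T : T w ≡ false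
        w∉T = trans (sym (trans (cong (λ t → T w ∧ not t) (≢⇒== (arc⇒≢ C a→w ∘ sym))) (Bool.∧-identityʳ (T w)))) (proj₂ (proj₂ new))
        T∌w : ∀ {t} → T t ≡ true → t ≢ w
        T∌w Tt refl = true≢false Tt w∉T
        a→ : ∀ {t} → T t ≡ true → t ≢ a → A a t ≡ true
        a→ Tt t≢a = dense v a _ v-low Ta Tt (t≢a ∘ sym)
        t→w : ∀ t → T t ≡ true → A t w ≡ true
        t→w t Tt with t ≟ a
        ... | yes refl = a→w
        ... | no t≢a = dense a t w a-low (a→ Tt t≢a) a→w (T∌w Tt)
        w→t : ∀ t → T t ≡ true → A w t ≡ true
        w→t t Tt with t ≟ a
        ... | no t≢a = dense a w t a-low a→w (a→ Tt t≢a) (T∌w Tt ∘ sym)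
        -- The arc from w to a itself needs a second low vertex b of T, which points to both.
        ... | yes refl = dense b w a b-low (t→w b Tb) (dense v b a v-low Tb Ta b≢a) (T∌w Ta ∘ sym)
        enlarged : IsClique A (λ u → (u == w) ∨ T u)
        enlarged x y p q x≢y with ∨-elim {x == w} p | ∨-elim {y == w} q
        ... | inj₁ e | inj₁ e′ = contradiction (trans (==⇒≡ x w e) (sym (==⇒≡ y w e′))) x≢y
        ... | inj₁ e | inj₂ Ty = subst (λ z → A z y ≡ true) (sym (==⇒≡ x w e)) (w→t y Ty)
        ... | inj₂ Tx | inj₁ e = subst (λ z → A x z ≡ true) (sym (==⇒≡ y w e)) (t→w x Tx)
        ... | inj₂ Tx | inj₂ Ty = dense v x y v-low Tx Ty x≢y

    -- If z formed a digon with every vertex of Q, there would be a clique of size N + 1. Otherwise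
    -- some q fails, a low vertex of Q other than q points to q and z, and the resulting fork allows
    -- `excess-lower` for A and for its reversal.
    no-hub : ∀ Q → card Q ≡ N → IsClique A Q → Hub A Q → ⊥
    no-hub Q size clique H = outlier (any? λ q → (Q q Bool.≟ true) ×-dec (A q z ∧ A z q Bool.≟ false))
      where
      z = Hub.z H
      off-z : ∀ {q} → Q q ≡ true → q ≢ z
      off-z Qq refl = true≢false Qq (Hub.z∉ H)
      all-joined : (¬ ∃ λ q → Q q ≡ true × A q z ∧ A z q ≡ false) → IsClique A (λ u → (u == z) ∨ Q u)
      all-joined none x y p q x≢y with ∨-elim {x == z} p | ∨-elim {y == z} q
      ... | inj₁ e | inj₁ e′ = contradiction (trans (==⇒≡ x z e) (sym (==⇒≡ y z e′))) x≢y
      ... | inj₂ Qx | inj₂ Qy = clique x y Qx Qy x≢y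
      ... | inj₁ e | inj₂ Qy with bool-split (A y z ∧ A z y)
      ...   | inj₁ t = subst (λ u → A u y ≡ true) (sym (==⇒≡ x z e)) (proj₂ (∧-elim {A y z} t))
      ...   | inj₂ t = ⊥-elim (none (y , Qy , t))
      all-joined none x y p q x≢y | inj₂ Qx | inj₁ e with bool-split (A x z ∧ A z x)
      ...   | inj₁ t = subst (λ u → A x u ≡ true) (sym (==⇒≡ y z e)) (proj₁ (∧-elim {A x z} t))
      ...   | inj₂ t = ⊥-elim (none (x , Qx , t))
      lows : 3 ≤ card (λ u → Q u ∧ low A u)
      lows = many-low Q (≤-reflexive (sym size)) (clique-degree C Q size clique) small
      lows⁻ : 3 ≤ card (λ u → Q u ∧ low (flip A) u)
      lows⁻ = many-low Q (≤-reflexive (sym size))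
        (clique-degree (Crit-flip C) Q size (clique⁻ C Q size clique small)) (small⁻ C Q size clique small)
      outlier : Dec (∃ λ q → Q q ≡ true × A q z ∧ A z q ≡ false) → ⊥
      outlier (no none) = free ((λ u → (u == z) ∨ Q u) , trans (card-adjoin Q z (Hub.z∉ H)) (cong suc size) , all-joined none)
      outlier (yes (q , Qq , apart)) with ∃-other _ q (≤-trans (s≤s (s≤s z≤n)) lows)
      ... | v , v∈ , v≢q = fork-or-digon v q z (off-z Qq) (low⇒deg A v (proj₂ (∧-elim {Q v} v∈)))
            (clique v q Qv Qq v≢q) (Hub.from H v Qv (proj₂ (∧-elim {Q v} v∈))) apart λ F →
            <⇒≱ small (halve (card (λ u → Q u ∧ low (flip A) u)) (card (λ u → Q u ∧ low A u)) (excess A)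
              (excess-lower C Q size clique lows z (Hub.z∉ H) q Qq (Hub.from H)
                (λ u → Q u ∧ low (flip A) u) (λ i → proj₁ ∘ ∧-elim)
                (λ i t → Hub.to H i (proj₁ (∧-elim t)) (proj₂ (∧-elim {Q i} t))) F)
              (subst (λ e → N + card (λ u → Q u ∧ low A u) ≤ e + card (λ u → Q u ∧ low (flip A) u) + 2) (excess-flip C)
                (excess-lower (Crit-flip C) Q size (clique⁻ C Q size clique small) lows⁻ z (Hub.z∉ H) q Qq (Hub.to H)
                (λ u → Q u ∧ low A u) (λ i → proj₁ ∘ ∧-elim)
                (λ i t → Hub.from H i (proj₁ (∧-elim t)) (proj₂ (∧-elim {Q i} t))) (Fork-flip F))))
        where
        Qv = proj₁ (∧-elim {Q v} v∈)
        -- In the sum of both inequalities i and o cancel, leaving twice the desired one.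
        halve : ∀ i o e → N + i ≤ e + o + 2 → N + o ≤ e + i + 2 → N ≤ e + 2
        halve i o e h h′ with N ≤? e + 2
        ... | yes p = p
        ... | no ¬p = ⊥-elim (1+n≰n (begin
            suc (N + i + (N + o))              ≤⟨ s≤s (+-mono-≤ h h′) ⟩
            suc (e + o + 2 + (e + i + 2))      ≡⟨ solve 3 (λ i o e → con 1 :+ (e :+ o :+ con 2 :+ (e :+ i :+ con 2))
                                                    := (con 1 :+ (e :+ con 2)) :+ (e :+ con 2) :+ (i :+ o)) refl i o e ⟩
            suc (e + 2) + (e + 2) + (i + o)    ≤⟨ +-monoˡ-≤ (i + o) (+-mono-≤ (≰⇒> ¬p) (<⇒≤ (≰⇒> ¬p))) ⟩
            N + N + (i + o)                    ≡⟨ solve 3 (λ i o n → n :+ n :+ (i :+ o) := n :+ i :+ (n :+ o)) refl i o N ⟩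
            N + i + (N + o)                    ∎))
          where open ≤-Reasoning

    small⇒⊥ : ⊥
    small⇒⊥ = no-fork⇒⊥ λ x y F → no-hub (Fork.Q F) (Fork.size F) (Fork.clique F)
      (hub C (Fork.Q F) (Fork.size F) (Fork.clique F) small)

  -- Strong induction on the number of live vertices, which drops with each identification.
  excess-bound : ∀ k A → card (live A) ≤ k → Crit A → Free A → N ≤ excess A + 2
  excess-bound k A bound C free = decidable-stable (N ≤? excess A + 2) λ big →
      small⇒⊥ C free (smaller k bound) (≰⇒> big)
    where
    smaller : ∀ k → card (live A) ≤ k → Smaller A
    smaller zero bound B lt with ≤-trans lt bound
    ... | ()
    smaller (suc k) bound B lt = excess-bound k B (≤-pred (≤-trans lt bound))

-- Digraphs and their cycles

module Acyclic {m : ℕ} (M : Fin m → Fin m → Bool) (irr : ∀ v → M v v ≡ false)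
  (acyclic : ∀ l (f : Fin (2 + l) → Fin m) → Injective _≡_ _≡_ f →
    (∀ i → M (f (inject₁ i)) (f (suc i)) ≡ true) → M (f (fromℕ (suc l))) (f zero) ≡ true → ⊥) where

  module _ (g : ℕ → Fin m) (step : ∀ i → M (g i) (g (suc i)) ≡ true) where

    -- A repetition at minimal distance is an injective cycle.
    no-repetition : ∀ k d i → d ≤ k → g i ≡ g (i + suc d) → ⊥
    no-repetition k zero i _ e = true≢false
      (subst (λ v → M (g i) v ≡ true) (trans (cong g (+-comm 1 i)) (sym e)) (step i)) (irr (g i))
    no-repetition (suc k) (suc l) i (s≤s l≤k) e with any? (λ t → any? λ t′ → (t Fin.<? t′) ×-dec (g (i + toℕ t) ≟ g (i + toℕ t′)))
    ... | yes (t , t′ , t<t′ , e′) = no-repetition k d (i + toℕ t)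
        (≤-trans (≤-pred (≤-trans (≤-trans (m≤n+m (suc d) (toℕ t)) (≤-reflexive t+d)) (≤-pred (toℕ<n t′)))) l≤k)
        (trans e′ (cong g (trans (cong (i +_) (sym t+d)) (sym (+-assoc i (toℕ t) (suc d))))))
      where
      d : ℕ
      d = toℕ t′ ∸ suc (toℕ t)
      t+d : toℕ t + suc d ≡ toℕ t′
      t+d = trans (+-suc (toℕ t) d) (m+[n∸m]≡n t<t′)
    ... | no distinct = acyclic l f injective
        (λ j → subst₂ (λ a b → M (g (i + a)) (g b) ≡ true) (sym (toℕ-inject₁ j)) (sym (+-suc i (toℕ j))) (step (i + toℕ j)))
        (subst₂ (λ a b → M (g (i + a)) b ≡ true) (sym (toℕ-fromℕ (suc l)))
          (trans (cong g (sym (+-suc i (suc l)))) (trans (sym e) (cong g (sym (+-identityʳ i))))) (step (i + suc l)))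
      where
      f : Fin (2 + l) → Fin m
      f t = g (i + toℕ t)
      injective : Injective _≡_ _≡_ f
      injective {t} {t′} e′ with <-cmp (toℕ t) (toℕ t′)
      ... | tri< lt _ _ = ⊥-elim (distinct (t , t′ , lt , e′))
      ... | tri≈ _ eq _ = toℕ-injective eq
      ... | tri> _ _ gt = ⊥-elim (distinct (t′ , t , gt , sym e′))

    no-walk : ⊥
    no-walk with pigeonhole (n<1+n m) (g ∘ toℕ)
    ... | i , j , i<j , e = no-repetition d d (toℕ i) ≤-refl (trans e (cong g (sym (trans (+-suc (toℕ i) d) (m+[n∸m]≡n i<j)))))
      where
      d : ℕ
      d = toℕ j ∸ suc (toℕ i)

  Ranked : (Fin m → Bool) → Set
  Ranked P = Σ (Fin m → ℕ) λ r → ∀ u v → P u ≡ true → P v ≡ true → M u v ≡ true → r u < r v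

  successor? : ∀ (P : Fin m → Bool) u → Dec (∃ λ w → P w ≡ true × M u w ≡ true)
  successor? P u = any? λ w → (P w Bool.≟ true) ×-dec (M u w Bool.≟ true)

  add-sink : ∀ (P : Fin m → Bool) s → ¬ (∃ λ w → P w ≡ true × M s w ≡ true) → Ranked (λ u → P u ∧ not (u == s)) → Ranked P
  add-sink P s sink (r , h) = r′ , ok
    where
    r′ : Fin m → ℕ
    r′ u = if u == s then suc (sum r) else r u
    ok : ∀ u v → P u ≡ true → P v ≡ true → M u v ≡ true → r′ u < r′ v
    ok u v p q a with u ≟ s | v ≟ s
    ... | yes refl | _ = ⊥-elim (sink (v , q , a))
    ... | no _ | yes refl = s≤s (term≤sum r u)
    ... | no u≢s | no v≢s = h u v (∧-intro p (not-intro (≢⇒== u≢s))) (∧-intro q (not-intro (≢⇒== v≢s))) a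

  -- Sinks are peeled off one by one, each ranked above what remains. A set without sinks must be
  -- empty, since any element would start an infinite walk.
  rank : ∀ k (P : Fin m → Bool) → card P ≤ k → Ranked P
  rank k P bound with any? (λ s → (P s Bool.≟ true) ×-dec ¬? (successor? P s))
  ... | yes (s , Ps , sink) = peel k bound
    where
    peel : ∀ k → card P ≤ k → Ranked P
    peel zero bound = ⊥-elim (<⇒≱ (≤-trans (s≤s z≤n) (≤-reflexive (card-remove P s Ps))) bound)
    peel (suc k) bound = add-sink P s sink (rank k _ (≤-pred (≤-trans (≤-reflexive (card-remove P s Ps)) bound)))
  ... | no no-sink = (λ _ → 0) , λ u _ p → ⊥-elim (no-walk (proj₁ ∘ walk u p) λ i → proj₂ (proj₂ (next _ (proj₂ (walk u p i)))))
    where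
    next : ∀ u → P u ≡ true → ∃ λ w → P w ≡ true × M u w ≡ true
    next u p = decidable-stable (successor? P u) λ none → no-sink (u , p , none)
    walk : ∀ u → P u ≡ true → ℕ → ∃ λ w → P w ≡ true
    walk u p zero = u , p
    walk u p (suc i) with next _ (proj₂ (walk u p i))
    ... | w , q , _ = w , q

module _ {m N : ℕ} (S : Fin m → Set) (R : Fin m → Fin m → Set) where
  open Critical m N

  -- A cycle of monochromatic arcs lies in one colour class, so these arcs are acyclic and can be
  -- ranked. Irreflexivity covers loops, as `Cycle` has at least two vertices.
  Dicolourable⇒Col : ∀ B → Irreflexive B → (∀ u v → B u v ≡ true → S u × S v × R u v) → Dicolourable S R N → Col B
  Dicolourable⇒Col B irr B⇒ (c , none) = c , proj₁ ranked , λ u v b e →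
      proj₂ ranked u v refl refl (∧-intro b (dec-true (c u ≟ c v) e))
    where
    M : Rel
    M u v = B u v ∧ (c u == c v)
    B-of : ∀ {u v} → M u v ≡ true → S u × S v × R u v
    B-of {u} {v} t = B⇒ u v (proj₁ (∧-elim t))
    acyclic : ∀ l (f : Fin (2 + l) → Fin m) → Injective _≡_ _≡_ f →
      (∀ i → M (f (inject₁ i)) (f (suc i)) ≡ true) → M (f (fromℕ (suc l))) (f zero) ≡ true → ⊥
    acyclic l f inj steps last = none (c (f zero))
      (l , f , inj , inS , mono , (λ i → proj₂ (proj₂ (B-of (steps i)))) , proj₂ (proj₂ (B-of last)))
      where
      inS : ∀ i → S (f i)
      inS zero = proj₁ (proj₂ (B-of last))
      inS (suc i) = proj₁ (proj₂ (B-of (steps i)))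
      mono : ∀ i → c (f i) ≡ c (f zero)
      mono = <-weakInduction (λ i → c (f i) ≡ c (f zero)) refl λ i e →
        trans (sym (==⇒≡ (c (f (inject₁ i))) (c (f (suc i))) (proj₂ (∧-elim {B (f (inject₁ i)) (f (suc i))} (steps i))))) e
    open Acyclic M (λ v → cong (_∧ (c v == c v)) (irr v)) acyclic
    ranked : Ranked (λ _ → true)
    ranked = rank m (λ _ → true) (card≤ _)

  -- Along a monochromatic cycle the ranks would increase and yet return to the start.
  Col⇒Dicolourable : ∀ B → (∀ u v → R u v → B u v ≡ true) → Col B → Dicolourable S R N
  Col⇒Dicolourable B R⇒B (c , r , h) = c , λ j → λ { (l , f , _ , _ , mono , steps , last) →
    <⇒≱ (h _ _ (R⇒B _ _ last) (trans (mono _) (sym (mono _))))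
      (<-weakInduction (λ i → r (f zero) ≤ r (f i)) ≤-refl
        (λ i le → ≤-trans le (<⇒≤ (h _ _ (R⇒B _ _ (steps i)) (trans (mono _) (sym (mono _)))))) (fromℕ (suc l))) }

-- Dicritical digraphs: translation and conclusion

neqB-≢ : ∀ {k} {u v : Fin k} → u ≢ v → neqB u v ≡ true
neqB-≢ {u = zero} {zero} u≢v = contradiction refl u≢v
neqB-≢ {u = zero} {suc v} _ = refl
neqB-≢ {u = suc u} {zero} _ = refl
neqB-≢ {u = suc u} {suc v} u≢v = neqB-≢ (u≢v ∘ cong suc)

complete⇒Isomorphic : ∀ G {k} → n G ≡ k → (∀ u v → u ≢ v → arc G u v ≡ true) → Isomorphic G (CompleteSym k)
complete⇒Isomorphic G refl complete = ⤖-id _ , same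
  where
  same : ∀ u v → arc G u v ≡ neqB u v
  same u v with u ≟ v
  ... | yes refl = trans (loopless G u) (sym (neqB-refl u))
  ... | no u≢v = trans (complete u v u≢v) (sym (neqB-≢ u≢v))

sumList-tabulate : ∀ {m} (f : Fin m → ℕ) → sumList (tabulate f) ≡ sum f
sumList-tabulate {zero} f = refl
sumList-tabulate {suc m} f = cong (f zero +_) (sumList-tabulate (f ∘ suc))

sumList-allFin : ∀ {m} (f : Fin m → ℕ) → sumList (map f (allFin m)) ≡ sum f
sumList-allFin f = trans (cong sumList (map-tabulate (λ i → i) f)) (sumList-tabulate f)

arcCount≡ : ∀ G → arcCount G ≡ sum λ u → card (arc G u)
arcCount≡ G = trans (sumList-allFin {n G} _) (sum-cong-≗ {n G} λ u → trans (sumList-allFin {n G} _) (sum-cong-≗ {n G} λ v → indicator (arc G u v)))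
  where
  indicator : ∀ b → (if b then 1 else 0) ≡ [ b ]
  indicator true = refl
  indicator false = refl

module _ (j : ℕ) (G : Digraph) (D : Dicritical (4 + j) G) where
  private
    m = n G
    N = 3 + j
    A = arc G
  open Critical m N
  open ExcessBound m N (s≤s (s≤s (s≤s z≤n)))
  open CliqueOfSizeN m N (s≤s (s≤s (s≤s z≤n)))
  open Counting m N 0<N

  ¬Col-G : ¬ Col A
  ¬Col-G = proj₂ (proj₁ D) ∘ Col⇒Dicolourable _ _ A (λ _ _ a → a)

  sub : (V : VSet) (B : Rel) → B ⊆ A → (∀ u v → B u v ≡ true → V u ≡ true × V v ≡ true) → Subdigraph G
  sub V B B⊆A inside = record { inV = V ; inA = B ; inA⊆ = λ u v b → B⊆A u v b , inside u v b }

  proper⇒Col : (V : VSet) (B : Rel) (s : B ⊆ A) (t : ∀ u v → B u v ≡ true → V u ≡ true × V v ≡ true) →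
    Proper (sub V B s t) → Col B
  proper⇒Col V B s t proper = Dicolourable⇒Col _ _ B
    (λ v → false-intro λ b → true≢false (s v v b) (loopless G v))
    (λ u v b → proj₁ (t u v b) , proj₂ (t u v b) , b) (proj₂ D (sub V B s t) proper)

  restrict-proper⇒Col : (V : VSet) → Proper (sub V (restrict A V) (restrict⊆ A V) λ u v b → ∧-elim (proj₂ (∧-elim {A u v} b))) →
    Col (restrict A V)
  restrict-proper⇒Col V = proper⇒Col V (restrict A V) (restrict⊆ A V) (λ u v b → ∧-elim (proj₂ (∧-elim {A u v} b)))

  -- The subdigraph keeps all vertices, so the missing arc is what makes it proper.
  critical : Crit A
  critical = record
    { irr = loopless G
    ; ¬col = ¬Col-G
    ; crit = λ B s u v a b ¬cB → ¬cB (proper⇒Col (λ _ → true) B s (λ _ _ _ → refl , refl)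
        λ { (_ , same) → true≢false (trans (same u v) a) b }) }

  -- A dead vertex meets no arc, so a colouring after its deletion would already colour all of G.
  all-live : ∀ v → live A v ≡ true
  all-live v with bool-split (live A v)
  ... | inj₁ l = l
  ... | inj₂ dead = ⊥-elim (¬Col-G (extend (restrict-proper⇒Col V λ { (all , _) → true≢false (all v) (cong not (==-refl v)) })))
    where
    V : VSet
    V u = not (u == v)
    V-intro : ∀ {u} → live A u ≡ true → V u ≡ true
    V-intro {u} l = not-intro (≢⇒== {u = u} {v} λ { refl → true≢false l dead })
    extend : Col (restrict A V) → Col A
    extend (c , r , h) = c , r , λ u w a → h u w
      (restrict-intro A V a (V-intro (arc⇒live critical a)) (V-intro (arc⇒live′ critical a)))

  -- A clique on k vertices either is all of G, which is then complete, or induces a proper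
  -- subdigraph. The latter has an N-colouring, yet digons force N + 1 distinct colours.
  free-of-cliques : ¬ Isomorphic G (CompleteSym (4 + j)) → Free A
  free-of-cliques ¬iso (Q , size , clique)
    with all? (λ v → Q v Bool.≟ true) ×-dec all? (λ u → all? λ v → restrict A Q u v Bool.≟ A u v)
  ... | yes (all , _) = ¬iso (complete⇒Isomorphic G
      (trans (sym (trans (sum-cong-≗ λ v → [true] (all v)) (sum-const-1 m))) size)
      λ u v → clique u v (all u) (all v))
  ... | no proper with restrict-proper⇒Col Q proper
  ...   | c , r , h = 1+n≰n (≤-trans (≤-reflexive (sym size)) (card-injective c Q inj))
    where
    inj : ∀ u v → Q u ≡ true → Q v ≡ true → c u ≡ c v → u ≡ v
    inj u v p q e with u ≟ v
    ... | yes u≡v = u≡v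
    ... | no u≢v = ⊥-elim (<-asym (h u v (restrict-intro A Q (clique u v p q u≢v) p q) e)
      (h v u (restrict-intro A Q (clique v u q p (u≢v ∘ sym)) q p) (sym e)))

  -- All m vertices are live, so there are N m arcs plus the excess, and N - 2 is `suc j`.
  arc-bound : ¬ Isomorphic G (CompleteSym (4 + j)) → N * m + suc j ≤ arcCount G
  arc-bound ¬iso = begin
      N * m + suc j                         ≤⟨ +-monoʳ-≤ (N * m) (+-cancelʳ-≤ 2 (suc j) (excess A)
                                                 (≤-trans (≤-reflexive (+-comm (suc j) 2)) (excess-bound m A (card≤ (live A)) critical (free-of-cliques ¬iso)))) ⟩
      N * m + excess A                      ≡⟨ +-comm (N * m) (excess A) ⟩
      excess A + N * m                      ≡⟨ cong (λ t → excess A + N * t) (sym (trans (sum-cong-≗ λ v → [true] (all-live v)) (sum-const-1 m))) ⟩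
      excess A + N * card (live A)          ≡⟨ sym (arcs≡excess+ critical) ⟩
      arcs A                                ≡⟨ sym (arcCount≡ G) ⟩
      arcCount G                            ∎
    where open ≤-Reasoning

theorem1p4 : (k : ℕ) → k ≥ 4 → (G : Digraph) → Dicritical k G →
    ¬ Isomorphic G (CompleteSym k) →
    arcCount G ≥ (k ∸ 1) * n G + (k ∸ 3)
theorem1p4 _ (s≤s (s≤s (s≤s (s≤s {n = j} z≤n)))) G D ¬iso = arc-bound j G D ¬iso
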